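{- Fix an integer $k$. Any $\alpha$-approximation of the metric of $GRID_n$ by a distribution over dominating metrics of graphs of treewidth $k$ has $\alpha=\Omega(\log n)$ (the implicit constant depending on $k$).
   Context: $GRID_n$ denotes the planar $n\times n$ grid graph with its shortest-path metric $d$. An $\alpha$-approximation of $d$ by a distribution over dominating metrics of graphs of treewidth $k$ is a probability distribution over pairs $(H,\Phi_H)$, where $H$ is a graph of treewidth $k$ and $\Phi_H$ maps vertices of $GRID_n$ to vertices of $H$, such that $d_H(\Phi_H(x),\Phi_H(y))\ge d(x,y)$ always and $\mathbb{E}[d_H(\Phi_H(x),\Phi_H(y))]\le \alpha\, d(x,y)$ for all vertices $x,y$. -}

module Defs where

open import Level using (0ℓ)
open import Data.Nat.Base as ℕ using (ℕ; zero; suc)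
open import Data.Fin.Base using (Fin; toℕ)
open import Data.Fin.Subset using (Subset; ∣_∣) renaming (_∈_ to _∈ˢ_)
open import Data.List.Base using (List; []; _∷_)
open import Data.List.Relation.Unary.All using (All)
open import Data.List.Relation.Unary.Unique.Propositional using (Unique)
open import Data.Nat.Properties using () renaming (_≟_ to _≟ℕ_)
open import Data.Fin.Properties using () renaming (_≟_ to _≟ᶠ_)
open import Data.Product.Base using (Σ-syntax; ∃-syntax; _×_; _,_)
open import Data.Sum.Base using (_⊎_; inj₁; inj₂)
open import Function.Base using (case_of_)
open import Function.Bundles using (_⇔_; Equivalence)
open import Relation.Binary.Core using (Rel)
open import Relation.Binary.Definitions using (Symmetric; Irreflexive; Decidable)
open import Relation.Binary.Structures using (IsStrictPartialOrder)
open import Relation.Binary.PropositionalEquality.Core using (_≡_; _≢_; refl; sym)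
open import Relation.Nullary.Negation.Core using (¬_)
open import Relation.Nullary.Decidable using (_×-dec_; _⊎-dec_)
open import Relation.Unary using (Pred; U; ∁; ⋃; _⊥_)
open import Algebra.Bundles using (CommutativeRing)
open import Algebra.Apartness.Bundles using (HeytingField; HeytingCommutativeRing)
import Algebra.Apartness.Properties.HeytingCommutativeRing as HeytingProperties
import Algebra.Properties.Ring as RingProperties
import Algebra.Definitions.RawMonoid as RawMonoidDefinitions

-- The real numbers are given by their axioms: a Cauchy-complete
-- Archimedean ordered field.  Classically these axioms determine ℝ up to
-- isomorphism; they are phrased with apartness and strict order so that
-- they are the usual axioms for the constructive reals as well.

record Reals : Set₁ where
  field
    heytingField : HeytingField 0ℓ 0ℓ 0ℓ

  open HeytingField heytingField public
    using (Carrier; _≈_; _#_; _+_; _*_; -_; _-_; 0#; 1#; isHeytingField;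
           heytingCommutativeRing)

  private
    module F = HeytingField heytingField
    module R = CommutativeRing (HeytingCommutativeRing.commutativeRing F.heytingCommutativeRing)

  -- n · x is the n-fold sum x + ⋯ + x.
  open RawMonoidDefinitions R.+-rawMonoid public
    using (sum) renaming (_×_ to _·_)

  infix 4 _<_ _≤_

  field
    _<_                  : Rel Carrier 0ℓ
    isStrictPartialOrder : IsStrictPartialOrder _≈_ _<_
    #⇔<⊎>                : ∀ x y → x # y ⇔ (x < y ⊎ y < x)
    +-monoˡ-<            : ∀ x y z → y < z → x + y < x + z
    *-pos                : ∀ x y → 0# < x → 0# < y → 0# < x * y
    archimedean          : ∀ x → ∃[ n ] x < n · 1#

  _≤_ : Rel Carrier 0ℓ
  x ≤ y = ¬ (y < x)

  _⟶_ : (ℕ → Carrier) → Carrier → Set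
  a ⟶ l = ∀ ε → 0# < ε →
    ∃[ N ] ∀ n → N ℕ.≤ n → (a n - l < ε) × (l - a n < ε)

  Cauchy : (ℕ → Carrier) → Set
  Cauchy a = ∀ ε → 0# < ε →
    ∃[ N ] ∀ m n → N ℕ.≤ m → N ℕ.≤ n → a m - a n < ε

  field
    complete : ∀ a → Cauchy a → ∃[ l ] a ⟶ l

  0<1 : 0# < 1#
  0<1 = case Equivalence.to (#⇔<⊎> 1# 0#) (HeytingProperties.1#0 heytingCommutativeRing) of λ where
      (inj₁ 1<0) → <-respʳ-≈ [-1]²≈1 (*-pos _ _ (0<-1 1<0) (0<-1 1<0))
      (inj₂ 0<1) → 0<1
    where
    open IsStrictPartialOrder isStrictPartialOrder using (<-respʳ-≈; <-respˡ-≈)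
    module P = RingProperties R.ring

    0<-1 : 1# < 0# → 0# < - 1#
    0<-1 p = <-respˡ-≈ (R.-‿inverseˡ 1#)
      (<-respʳ-≈ (R.+-identityʳ (- 1#)) (+-monoˡ-< (- 1#) 1# 0# p))

    [-1]²≈1 : - 1# * - 1# ≈ 1#
    [-1]²≈1 = R.trans (P.-1*x≈-x (- 1#)) (P.-‿involutive 1#)

  HasSum : (ℕ → Carrier) → Carrier → Set
  HasSum a s = (λ n → sum {n} (λ i → a (toℕ i))) ⟶ s

record Graph (V : Set) : Set₁ where
  field
    Adj    : Rel V 0ℓ
    symm   : Symmetric Adj
    irrefl : Irreflexive _≡_ Adj
    adj?   : Decidable Adj

  data Walk : V → V → Set where
    stop : ∀ {u} → Walk u u
    step : ∀ {u v w} → Adj u v → Walk v w → Walk u w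

  vertices : ∀ {u v} → Walk u v → List V
  vertices {u} stop       = u ∷ []
  vertices {u} (step _ p) = u ∷ vertices p

  steps : ∀ {u v} → Walk u v → ℕ
  steps stop       = zero
  steps (step _ p) = suc (steps p)

  Connected : Set
  Connected = ∀ u v → Walk u v

  -- A cycle is a path with at least two edges whose ends are adjacent.
  Acyclic : Set
  Acyclic = ∀ {u v} (p : Walk u v) → Unique (vertices p) →
    2 ℕ.≤ steps p → ¬ Adj v u

  IsTree : Set
  IsTree = Connected × Acyclic

open Graph using (Walk; stop; step)

record TreeDecomposition {m : ℕ} (G : Graph (Fin m)) : Set₁ where
  field
    nodes       : ℕ
    tree        : Graph (Fin nodes)
    isTree      : Graph.IsTree tree
    bag         : Fin nodes → Subset m
    coverVertex : ∀ v → ∃[ t ] v ∈ˢ bag t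
    coverEdge   : ∀ {u v} → Graph.Adj G u v → ∃[ t ] (u ∈ˢ bag t × v ∈ˢ bag t)
    connected   : ∀ v s t → v ∈ˢ bag s → v ∈ˢ bag t →
      Σ[ p ∈ Walk tree s t ] All (λ r → v ∈ˢ bag r) (Graph.vertices tree p)

Treewidth≤ : ∀ {m} → Graph (Fin m) → ℕ → Set₁
Treewidth≤ G k = Σ[ D ∈ TreeDecomposition G ]
  let open TreeDecomposition D in ∀ t → ∣ bag t ∣ ℕ.≤ suc k

Consecutive : ∀ {n} → Rel (Fin n) 0ℓ
Consecutive i j = (toℕ j ≡ suc (toℕ i)) ⊎ (toℕ i ≡ suc (toℕ j))

GRID : (n : ℕ) → Graph (Fin n × Fin n)
GRID n = record
  { Adj    = λ (i , j) (i′ , j′) →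
      (i ≡ i′ × Consecutive j j′) ⊎ (Consecutive i i′ × j ≡ j′)
  ; symm   = λ where
      (inj₁ (e , c)) → inj₁ (sym e , swap c)
      (inj₂ (c , e)) → inj₂ (swap c , sym e)
  ; irrefl = λ where
      refl (inj₁ (_ , c)) → irr c
      refl (inj₂ (c , _)) → irr c
  ; adj?   = λ (i , j) (i′ , j′) →
      ((i ≟ᶠ i′) ×-dec con? j j′) ⊎-dec (con? i i′ ×-dec (j ≟ᶠ j′))
  }
  where
  swap : ∀ {i j : Fin n} → Consecutive i j → Consecutive j i
  swap (inj₁ e) = inj₂ e
  swap (inj₂ e) = inj₁ e

  m≢1+m : ∀ {m} → m ≢ suc m
  m≢1+m ()

  irr : ∀ {i : Fin n} → ¬ Consecutive i i
  irr (inj₁ e) = m≢1+m e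
  irr (inj₂ e) = m≢1+m e

  con? : Decidable (Consecutive {n})
  con? i j = (toℕ j ≟ℕ suc (toℕ i)) ⊎-dec (toℕ i ≟ℕ suc (toℕ j))

module Metric (ℝ : Reals) where

  open Reals ℝ

  record WeightedGraph (V : Set) : Set₁ where
    field
      graph      : Graph V
      weight     : V → V → Carrier
      weight-sym : ∀ {u v} → Graph.Adj graph u v → weight u v ≈ weight v u
      weight-pos : ∀ {u v} → Graph.Adj graph u v → 0# < weight u v

    length : ∀ {u v} → Walk graph u v → Carrier
    length stop               = 0#
    length (step {u} {v} _ p) = weight u v + length p

  -- Every two vertices have a distance, so the graph is connected.
  record ShortestPathMetric {V : Set} (G : WeightedGraph V) : Set where
    open WeightedGraph G
    field
      dist     : V → V → Carrier
      attained : ∀ u v → Σ[ p ∈ Walk graph u v ] length p ≈ dist u v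
      shortest : ∀ {u v} (p : Walk graph u v) → dist u v ≤ length p

  -- Equality of subsets, insensitive to double negation.  In classical
  -- logic this is just extensional equality; without excluded middle it
  -- makes A ∪ ∁ A equal to the whole space and ∁ (∁ A) equal to A.
  infix 4 _≋_
  _≋_ : ∀ {Ω : Set₁} → Pred Ω 0ℓ → Pred Ω 0ℓ → Set₁
  A ≋ B = ∀ ω → (¬ A ω) ⇔ (¬ B ω)

  record ProbabilityMeasure (Ω : Set₁) : Set₂ where
    field
      Event      : Pred Ω 0ℓ → Set₁
      event-resp : ∀ {A B} → A ≋ B → Event A → Event B
      event-U    : Event U
      event-∁    : ∀ {A} → Event A → Event (∁ A)
      event-⋃    : ∀ {A : ℕ → Pred Ω 0ℓ} → (∀ i → Event (A i)) → Event (⋃ ℕ A)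

      prob       : ∀ {A} → Event A → Carrier
      prob-≥0    : ∀ {A} (a : Event A) → 0# ≤ prob a
      prob-U     : prob event-U ≈ 1#
      σ-additive : ∀ {A : ℕ → Pred Ω 0ℓ} {B} →
        (a : ∀ i → Event (A i)) (b : Event B) →
        (∀ i j → i ≢ j → A i ⊥ A j) → B ≋ ⋃ ℕ A →
        HasSum (λ i → prob (a i)) (prob b)

  module _ {Ω : Set₁} (μ : ProbabilityMeasure Ω) where
    open ProbabilityMeasure μ

    Measurable : (Ω → Carrier) → Set₁
    Measurable X = ∀ t → Event (λ ω → t ≤ X ω)

    -- A non-negative simple function, equal to value i on piece i and to
    -- 0# off the pieces, that lies below a non-negative X.
    record SimpleBelow (X : Ω → Carrier) : Set₁ where
      field
        {pieces} : ℕ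
        {piece}  : Fin pieces → Pred Ω 0ℓ
        event    : ∀ i → Event (piece i)
        disjoint : ∀ i j → i ≢ j → piece i ⊥ piece j
        value    : Fin pieces → Carrier
        value-≥0 : ∀ i → 0# ≤ value i
        below    : ∀ i ω → piece i ω → value i ≤ X ω

      integral : Carrier
      integral = sum (λ i → value i * prob (event i))

    -- The Lebesgue integral of a non-negative measurable X is the supremum
    -- of the integrals of the simple functions below it.
    record HasExpectation (X : Ω → Carrier) (e : Carrier) : Set₁ where
      field
        nonNegative : ∀ ω → 0# ≤ X ω
        measurable  : Measurable X
        upper       : (s : SimpleBelow X) → SimpleBelow.integral s ≤ e
        least       : ∀ b → ((s : SimpleBelow X) → SimpleBelow.integral s ≤ b) →
                      e ≤ b

  -- The pair (H , Φ), H being finite with positive edge weights.  It also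
  -- carries its metric and a tree decomposition; a distribution over bare
  -- pairs pulls back to one over these.
  record DominatingEmbedding (k : ℕ) {X : Set} (d : X → X → Carrier) : Set₁ where
    field
      size      : ℕ
      H         : WeightedGraph (Fin size)
      treewidth : Treewidth≤ (WeightedGraph.graph H) k
      metric    : ShortestPathMetric H
      Φ         : X → Fin size

    stretched : X → X → Carrier
    stretched x y = ShortestPathMetric.dist metric (Φ x) (Φ y)

    field
      dominates : ∀ x y → d x y ≤ stretched x y

  open DominatingEmbedding using (stretched)

  record Approximation (k : ℕ) {X : Set} (d : X → X → Carrier) (α : Carrier)
         : Set₂ where
    field
      distribution : ProbabilityMeasure (DominatingEmbedding k d)
      expected     : ∀ x y → ∃[ e ]
        (HasExpectation distribution (λ E → stretched E x y) e × e ≤ α * d x y)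

  unitWeights : ∀ {V} → Graph V → WeightedGraph V
  unitWeights G = record
    { graph      = G
    ; weight     = λ _ _ → 1#
    ; weight-sym = λ _ → HeytingField.refl heytingField
    ; weight-pos = λ _ → 0<1
    }

{-# OPTIONS --safe #-}

-- Fix an embedding into a graph H of treewidth k, put K = k + 2, and look at
-- a scale L = 2 ^ i.  Cut the grid into square blocks of side 4KL, and each
-- block into K strips of 4L rows and K strips of 4L columns.  If fewer than 2L
-- vertices of a block have an edge stretched to at least L, then every strip
-- has, in its first half, a line without such an edge.  The K rows and K
-- columns so chosen are more than 2L apart, so H dominating the grid makes
-- their images (joined up by shortest paths of H) pairwise disjoint for the
-- rows and for the columns, while every row meets every column.  That is a
-- bramble of order K in H, which treewidth k excludes.  Hence a block has at
-- least 2L long edges and a grid of side N has at least 2L (N / 4KL)² of them.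
-- Summed over the scales with weight 2 ^ i, each of the Θ(log n) scales
-- contributes Θ(N²) to the total stretch of the O(N²) edges, whose expectation
-- is at most α per edge.

module Submission where

open import Defs
open Graph using (Walk; stop; step)
open import Level using (0ℓ)
open import Algebra.Apartness.Bundles using (HeytingField; HeytingCommutativeRing)
import Algebra.Apartness.Properties.HeytingCommutativeRing as HeytingProperties
open import Algebra.Bundles using (CommutativeRing)
import Algebra.Properties.CommutativeMonoid.Mult as CommutativeMonoidMult
import Algebra.Properties.CommutativeSemigroup as CommutativeSemigroupProperties
import Algebra.Properties.Ring as RingProperties
import Algebra.Properties.Semiring.Mult as SemiringMult
open import Data.Empty using (⊥; ⊥-elim)
open import Data.Fin.Base using (Fin; toℕ)
import Data.Fin.Properties as Finₚ
open import Data.Fin.Subset using (Subset; ∣_∣) renaming (_∈_ to _∈ˢ_; _-_ to _∖_)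
import Data.Fin.Subset.Properties as Subsetₚ
open import Data.List.Base using (List; []; _∷_; length; lookup; _++_)
open import Data.List.Membership.Propositional using (_∈_)
open import Data.List.Membership.Propositional.Properties using (∈-lookup)
import Data.List.Properties as Listₚ
open import Data.List.Relation.Unary.All as All using (All; []; _∷_)
import Data.List.Relation.Unary.All.Properties as Allₚ
open import Data.List.Relation.Unary.AllPairs using ([]; _∷_)
open import Data.List.Relation.Unary.Any using (here; there)
open import Data.List.Relation.Unary.Unique.Propositional using (Unique)
open import Data.Nat.Base as ℕ using (ℕ; zero; suc; z≤n; s≤s; _^_)
open import Data.Nat.DivMod using (_mod_; m%n<n; m<n⇒m%n≡m)
open import Data.Nat.Logarithm using (⌈log₂_⌉; ⌈log₂⌉-mono-≤; ⌈log₂2^n⌉≡n)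
import Data.Nat.Properties as ℕₚ
open import Data.Nat.Tactic.RingSolver using (solve-∀)
open import Data.Product.Base using (Σ-syntax; ∃-syntax; _×_; _,_; proj₁; proj₂)
open import Data.Sum.Base using (_⊎_; inj₁; inj₂)
open import Data.Unit.Base using (⊤; tt)
open import Function.Base using (_∘_)
open import Function.Bundles using (Equivalence; mk⇔)
open import Relation.Binary.Bundles using (Preorder)
open import Relation.Binary.Construct.Closure.ReflexiveTransitive as Star
  using (Star; ε; _◅_; _◅◅_)
open import Relation.Binary.Core using (Rel)
open import Relation.Binary.Definitions
  using (Symmetric; DecidableEquality; tri<; tri≈; tri>)
open import Relation.Binary.PropositionalEquality
  using (_≡_; _≢_; refl; sym; trans; cong; cong₂; subst; subst₂)
import Relation.Binary.Reasoning.Preorder as PreorderReasoning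
open import Relation.Binary.Structures using (IsStrictPartialOrder)
open import Relation.Nullary.Decidable
  using (Dec; yes; no; ¬?; _×-dec_; _⊎-dec_; decidable-stable)
open import Relation.Nullary.Negation.Core using (¬_; contradiction)
open import Relation.Unary using (Pred; U; ∁; ⋃; _∩_) renaming (_⊥_ to _disjointFrom_)

-- Walks, simple paths and acyclic graphs.

module _ {V : Set} where

  Unique-lookup-injective : {xs : List V} → Unique xs → ∀ {i j} →
    lookup xs i ≡ lookup xs j → i ≡ j
  Unique-lookup-injective (_ ∷ _)  {Fin.zero}  {Fin.zero}  _ = refl
  Unique-lookup-injective (x∉ ∷ _) {Fin.zero}  {Fin.suc j} e = contradiction e (All.lookup x∉ (∈-lookup j))
  Unique-lookup-injective (x∉ ∷ _) {Fin.suc i} {Fin.zero}  e = contradiction (sym e) (All.lookup x∉ (∈-lookup i))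
  Unique-lookup-injective (_ ∷ u)  {Fin.suc i} {Fin.suc j} e = cong Fin.suc (Unique-lookup-injective u e)

Unique-length≤ : ∀ {n} {xs : List (Fin n)} → Unique xs → length xs ℕ.≤ n
Unique-length≤ u = Finₚ.injective⇒≤ (Unique-lookup-injective u)

module Walks {V : Set} (G : Graph V) where
  open Graph G hiding (Walk; stop; step)

  infixr 5 _++ʷ_
  _++ʷ_ : ∀ {u v w} → Walk G u v → Walk G v w → Walk G u w
  stop     ++ʷ q = q
  step a p ++ʷ q = step a (p ++ʷ q)

  head∈ : ∀ {u v} (p : Walk G u v) → u ∈ vertices p
  head∈ stop       = here refl
  head∈ (step _ _) = here refl

  ∈-++ʳ : ∀ {u v w x} (p : Walk G u v) (q : Walk G v w) → x ∈ vertices q → x ∈ vertices (p ++ʷ q)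
  ∈-++ʳ stop       q i = i
  ∈-++ʳ (step _ p) q i = there (∈-++ʳ p q i)

  ∈-++⁻ : ∀ {u v w x} (p : Walk G u v) (q : Walk G v w) → x ∈ vertices (p ++ʷ q) →
    x ∈ vertices p ⊎ x ∈ vertices q
  ∈-++⁻ stop       q i         = inj₂ i
  ∈-++⁻ (step _ p) q (here e)  = inj₁ (here e)
  ∈-++⁻ (step _ p) q (there i) with ∈-++⁻ p q i
  ... | inj₁ j = inj₁ (there j)
  ... | inj₂ j = inj₂ j

  dropTo : ∀ {u v x} (p : Walk G u v) → x ∈ vertices p →
    Σ[ q ∈ Walk G x v ] ((∀ {y} → y ∈ vertices q → y ∈ vertices p) × (Unique (vertices p) → Unique (vertices q)))
  dropTo stop       (here refl) = stop , (λ i → i) , (λ u → u)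
  dropTo (step a p) (here refl) = step a p , (λ i → i) , (λ u → u)
  dropTo (step a p) (there i)   with dropTo p i
  ... | q , sub , uq = q , there ∘ sub , λ where (_ ∷ u) → uq u

  simplePath : DecidableEquality V → ∀ {u v} → Walk G u v → Σ[ p ∈ Walk G u v ] Unique (vertices p)
  simplePath _≟_ stop = stop , [] ∷ []
  simplePath _≟_ (step {u} a w) with simplePath _≟_ w
  ... | p , up with u ∈? vertices p
    where open import Data.List.Membership.DecPropositional _≟_ using (_∈?_)
  ...   | yes u∈p = let q , _ , uq = dropTo p u∈p in q , uq up
  ...   | no  u∉p = step a p , All.tabulate (λ { x∈p refl → u∉p x∈p }) ∷ up

-- A self-map of the vertices along edges without 2-cycles is eventually
-- periodic, and its period is a cycle of the graph.
module FunctionalGraph {n : ℕ} (T : Graph (Fin n)) (acyclic : Graph.Acyclic T)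
  (f : Fin n → Fin n) (f-adj : ∀ t → Graph.Adj T t (f t)) (f²≢id : ∀ t → f (f t) ≢ t) where
  open Graph T hiding (Walk; stop; step)
  open import Data.List.Membership.DecPropositional (Finₚ._≟_ {n}) using (_∈?_)

  -- Paths are built against the orientation of f, so that they grow at
  -- their first vertex.
  Backward : ∀ {u v} → Walk T u v → Set
  Backward stop               = ⊤
  Backward (step {u} {v} _ p) = u ≡ f v × Backward p

  takeTo : ∀ {u v x} (p : Walk T u v) → Unique (vertices p) → Backward p → x ∈ vertices p →
    Σ[ q ∈ Walk T u x ] (Unique (vertices q) × Backward q × (∀ {y} → y ∈ vertices q → y ∈ vertices p))
  takeTo stop       _        _       (here refl) = stop , [] ∷ [] , tt , λ i → i
  takeTo (step a p) _        _       (here refl) = stop , [] ∷ [] , tt , λ where (here e) → here e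
  takeTo (step a p) (u∉ ∷ u) (e , b) (there i) with takeTo p u b i
  ... | q , uq , bq , sub = step a q , All.tabulate (λ j → All.lookup u∉ (sub j)) ∷ uq , (e , bq) , λ where
    (here e)  → here e
    (there j) → there (sub j)

  -- With one step, `f` would swap `u` and `f u`; with more, the edge between `f u` and `u` closes
  -- the path to a cycle.
  close : ∀ {u} (q : Walk T u (f u)) → Unique (vertices q) → Backward q → ⊥
  close {u} q uq bq = 2≤⇒⊥ q uq bq refl
    where
    -- The end is freed to `w` so that the walk can be matched on.
    2≤⇒⊥ : ∀ {w} (q : Walk T u w) → Unique (vertices q) → Backward q → w ≡ f u → ⊥
    2≤⇒⊥ stop _ _ e = irrefl e (f-adj u)
    2≤⇒⊥ (step _ stop) _ (e , _) refl = f²≢id u (sym e)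
    2≤⇒⊥ q@(step _ (step _ _)) uq _ refl = acyclic q uq (s≤s (s≤s z≤n)) (symm (f-adj u))

  -- Prepending `f u` either repeats a vertex, and the part of the path up to it is closed, or
  -- lengthens the path; when the fuel is spent, the path has more than `n` distinct vertices.
  grow : ∀ fuel {u v} (p : Walk T u v) → Unique (vertices p) → Backward p →
    n ℕ.< length (vertices p) ℕ.+ fuel → ⊥
  grow zero p up _ n<l = ℕₚ.<⇒≱ n<l (subst (ℕ._≤ n) (sym (ℕₚ.+-identityʳ _)) (Unique-length≤ up))
  grow (suc fuel) {u} p up bp n<l with f u ∈? vertices p
  ... | yes i = let q , uq , bq , _ = takeTo p up bp i in close q uq bq
  ... | no  i = grow fuel (step (symm (f-adj u)) p) (All.tabulate (λ { j refl → i j }) ∷ up) (refl , bp)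
                  (subst (n ℕ.<_) (ℕₚ.+-suc _ fuel) n<l)

  ¬vertex : Fin n → ⊥
  ¬vertex t = grow (suc n) {t} stop ([] ∷ []) tt (ℕₚ.m<n⇒m<1+n (ℕₚ.n<1+n n))

module _ {n : ℕ} (T : Graph (Fin n)) where
  open Graph T hiding (Walk; stop; step)

  -- `Star (Avoiding t)` joins distinct vertices exactly when they lie in one component of `T` with
  -- `t` deleted.
  Avoiding : Fin n → Rel (Fin n) 0ℓ
  Avoiding t u v = Adj u v × u ≢ t × v ≢ t

  Avoiding-sym : ∀ t → Symmetric (Avoiding t)
  Avoiding-sym t (a , u≢ , v≢) = symm a , v≢ , u≢

  -- `t′` is the vertex that follows the last visit of the walk to `t`.
  stepTowards : ∀ {t c} → c ≢ t → Walk T t c → ∃[ t′ ] (Adj t t′ × Star (Avoiding t) t′ c)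
  stepTowards {t} {c} c≢t w with lastVisit w
    where
    lastVisit : ∀ {u} → Walk T u c → (u ≢ t × Star (Avoiding t) u c) ⊎ ∃[ t′ ] (Adj t t′ × Star (Avoiding t) t′ c)
    lastVisit stop = inj₁ (c≢t , ε)
    lastVisit (step {u} {v} a w) with lastVisit w
    ... | inj₂ r = inj₂ r
    ... | inj₁ (v≢t , s) with u Finₚ.≟ t
    ...   | yes refl = inj₂ (v , a , s)
    ...   | no  u≢t  = inj₁ (u≢t , (a , u≢t , v≢t) ◅ s)
  ... | inj₁ (t≢t , _) = contradiction refl t≢t
  ... | inj₂ r         = r

  removeEdge : Fin n → Fin n → Graph (Fin n)
  removeEdge s t = record
    { Adj    = λ u v → Adj u v × ¬ Cut u v
    ; symm   = λ (a , c) → symm a , c ∘ cut-sym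
    ; irrefl = λ e (a , _) → irrefl e a
    ; adj?   = λ u v → adj? u v ×-dec ¬? (((u Finₚ.≟ s) ×-dec (v Finₚ.≟ t)) ⊎-dec ((u Finₚ.≟ t) ×-dec (v Finₚ.≟ s)))
    }
    where
    Cut : Rel (Fin n) 0ℓ
    Cut u v = (u ≡ s × v ≡ t) ⊎ (u ≡ t × v ≡ s)

    cut-sym : ∀ {u v} → Cut u v → Cut v u
    cut-sym (inj₁ (a , b)) = inj₂ (b , a)
    cut-sym (inj₂ (a , b)) = inj₁ (b , a)

  -- Shortened to a simple path, the walk has at least two steps, and the removed edge closes it to
  -- a cycle.
  bridge : Acyclic → ∀ {s t} → Adj s t → ¬ Walk (removeEdge s t) t s
  bridge acyclic {s} {t} a w with Walks.simplePath (removeEdge s t) Finₚ._≟_ w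
  ... | stop , _ = irrefl refl a
  ... | step (_ , ¬cut) stop , _ = ¬cut (inj₂ (refl , refl))
  ... | p@(step _ (step _ _)) , u = acyclic (forget p) (subst Unique (sym (vertices-forget p)) u)
    (s≤s (s≤s z≤n)) a
    where
    forget : ∀ {u v} → Walk (removeEdge s t) u v → Walk T u v
    forget stop             = stop
    forget (step (a , _) p) = step a (forget p)

    vertices-forget : ∀ {u v} (p : Walk (removeEdge s t) u v) →
      vertices (forget p) ≡ Graph.vertices (removeEdge s t) p
    vertices-forget stop       = refl
    vertices-forget (step _ p) = cong (_ ∷_) (vertices-forget p)

  -- A step that avoids even one of `s` and `t` is not the edge between them.
  Star⇒Walk : ∀ {s t u v} → Star (λ u v → Avoiding s u v ⊎ Avoiding t u v) u v → Walk (removeEdge s t) u v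
  Star⇒Walk ε = stop
  Star⇒Walk (inj₁ (a , u≢ , v≢) ◅ p) = step (a , λ where
    (inj₁ (e , _)) → u≢ e
    (inj₂ (_ , e)) → v≢ e) (Star⇒Walk p)
  Star⇒Walk (inj₂ (a , u≢ , v≢) ◅ p) = step (a , λ where
    (inj₁ (_ , e)) → v≢ e
    (inj₂ (e , _)) → u≢ e) (Star⇒Walk p)

-- Brambles and tree decompositions.

injection⇒≤∣∣ : ∀ {m} K (S : Subset m) (f : Fin K → Fin m) → (∀ i → f i ∈ˢ S) →
  (∀ {i j} → f i ≡ f j → i ≡ j) → K ℕ.≤ ∣ S ∣
injection⇒≤∣∣ zero    S f f∈ inj = z≤n
injection⇒≤∣∣ (suc K) S f f∈ inj = ℕₚ.≤-<-trans
  (injection⇒≤∣∣ K (S ∖ f Fin.zero) (f ∘ Fin.suc)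
    (λ i → Subsetₚ.x∈p∧x≢y⇒x∈p-y (f∈ (Fin.suc i)) (λ e → Finₚ.0≢1+n (sym (inj e))))
    (Finₚ.suc-injective ∘ inj))
  (Subsetₚ.x∈p⇒∣p-x∣<∣p∣ (f∈ Fin.zero))

-- The crosses of a K × K grid form a bramble of order K, so a tree
-- decomposition of width at most K - 2 misses one of them at every node.
-- Orienting each node towards the cross that it misses gives a self-map of
-- the tree; two crosses meet, so the map has no 2-cycle.
module Bramble {m : ℕ} {G : Graph (Fin m)} (D : TreeDecomposition G) where
  open TreeDecomposition D
  open Graph using (vertices)

  Line : Set
  Line = ∃[ u ] ∃[ v ] Walk G u v

  infix 4 _∈ᴸ_ _meets_
  _∈ᴸ_ : Fin m → Line → Set
  x ∈ᴸ (_ , _ , p) = x ∈ vertices G p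

  _meets_ : Fin nodes → Line → Set
  t meets l = ∃[ x ] (x ∈ˢ bag t × x ∈ᴸ l)

  meets? : ∀ t l → Dec (t meets l)
  meets? t l = Finₚ.any? λ x → (x Subsetₚ.∈? bag t) ×-dec (x ∈? vertices G (proj₂ (proj₂ l)))
    where open import Data.List.Membership.DecPropositional (Finₚ._≟_ {m}) using (_∈?_)

  bag-path : ∀ {t x r s} → ¬ (x ∈ˢ bag t) → x ∈ˢ bag r → x ∈ˢ bag s → Star (Avoiding tree t) r s
  bag-path {t} {x} {r} {s} x∉ x∈r x∈s = go (proj₁ w) (proj₂ w)
    where
    w = connected x r s x∈r x∈s

    ≢t : ∀ {q} → x ∈ˢ bag q → q ≢ t
    ≢t x∈q refl = x∉ x∈q

    go : ∀ {r s} (p : Walk tree r s) → All (λ q → x ∈ˢ bag q) (vertices tree p) → Star (Avoiding tree t) r s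
    go stop _ = ε
    go (step a p) (x∈r ∷ x∈) = (a , ≢t x∈r , ≢t (All.lookup x∈ (Walks.head∈ tree p))) ◅ go p x∈

  -- Neighbours along the line share a bag, and the nodes whose bags hold a given vertex of the line
  -- are connected without `t`. So every node meeting the line is joined to the one that covers its
  -- last vertex.
  trace-connected : ∀ {t} l → ¬ (t meets l) → ∀ {r s} → r meets l → s meets l → Star (Avoiding tree t) r s
  trace-connected {t} (_ , w , p) t∌ (x , x∈r , x∈p) (y , y∈s , y∈p) =
    toEnd x∈r x∈p ◅◅ Star.reverse (Avoiding-sym tree t) (toEnd y∈s y∈p)
    where
    end = coverVertex w

    along : ∀ {r x} (q : Walk G x w) → (∀ {z} → z ∈ vertices G q → z ∈ vertices G p) → x ∈ˢ bag r →
      Star (Avoiding tree t) r (proj₁ end)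
    along stop sub x∈r = bag-path (λ x∈t → t∌ (_ , x∈t , sub (here refl))) x∈r (proj₂ end)
    along (step a q) sub x∈r =
      let _ , x∈s , y∈s = coverEdge a
      in bag-path (λ x∈t → t∌ (_ , x∈t , sub (here refl))) x∈r x∈s ◅◅ along q (sub ∘ there) y∈s

    toEnd : ∀ {r x} → x ∈ˢ bag r → x ∈ vertices G p → Star (Avoiding tree t) r (proj₁ end)
    toEnd x∈r x∈p = let q , sub , _ = Walks.dropTo G p x∈p in along q sub x∈r

  module _ {K : ℕ} (row col : Fin K → Line)
    (rows-disjoint : ∀ {i j x} → x ∈ᴸ row i → x ∈ᴸ row j → i ≡ j)
    (cols-disjoint : ∀ {i j x} → x ∈ᴸ col i → x ∈ᴸ col j → i ≡ j)
    (crossing : ∀ i j → ∃[ x ] (x ∈ᴸ row i × x ∈ᴸ col j))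
    (small : ∀ t → ∣ bag t ∣ ℕ.< K) where

    -- A bag meeting all the lines would contain a different vertex of each, so at least `K`
    -- vertices.
    missed : (line : Fin K → Line) → (∀ {i j x} → x ∈ᴸ line i → x ∈ᴸ line j → i ≡ j) →
      ∀ t → ∃[ i ] ¬ (t meets line i)
    missed line disjoint t = Finₚ.¬∀⟶∃¬ K (λ i → t meets line i) (λ i → meets? t (line i)) λ all →
      ℕₚ.<⇒≱ (small t) (injection⇒≤∣∣ K (bag t) (proj₁ ∘ all) (proj₁ ∘ proj₂ ∘ all)
        (λ {i} {j} e → disjoint (proj₂ (proj₂ (all i))) (subst (_∈ᴸ line j) (sym e) (proj₂ (proj₂ (all j))))))

    r c : Fin nodes → Fin K
    r t = proj₁ (missed row rows-disjoint t)
    c t = proj₁ (missed col cols-disjoint t)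

    node : Fin K → Fin K → Fin nodes
    node i j = proj₁ (coverVertex (proj₁ (crossing i j)))

    node-row : ∀ i j → node i j meets row i
    node-row i j = let x , x∈r , _ = crossing i j in x , proj₂ (coverVertex x) , x∈r

    node-col : ∀ i j → node i j meets col j
    node-col i j = let x , _ , x∈c = crossing i j in x , proj₂ (coverVertex x) , x∈c

    -- All nodes that meet the cross missed at `t` lie in one component of the tree without `t`;
    -- this node represents that component.
    centre : Fin nodes → Fin nodes
    centre t = node (r t) (c t)

    centre≢ : ∀ t → centre t ≢ t
    centre≢ t e = proj₂ (missed row rows-disjoint t) (subst (_meets row (r t)) e (node-row (r t) (c t)))

    next : ∀ t → ∃[ t′ ] (Graph.Adj tree t t′ × Star (Avoiding tree t) t′ (centre t))
    next t = stepTowards tree (centre≢ t) (proj₁ isTree t (centre t))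

    fromRow : ∀ t {s} → s meets row (r t) → Star (Avoiding tree t) s (centre t)
    fromRow t s∈ = trace-connected (row (r t)) (proj₂ (missed row rows-disjoint t)) s∈ (node-row _ _)

    fromCol : ∀ t {s} → s meets col (c t) → Star (Avoiding tree t) s (centre t)
    fromCol t s∈ = trace-connected (col (c t)) (proj₂ (missed col cols-disjoint t)) s∈ (node-col _ _)

    -- The row missed at `t` crosses the column missed at `t′`. If `t` and `t′` pointed at each
    -- other, a detour through the node of that crossing would join them without their edge, which
    -- is a bridge.
    next²≢id : ∀ t → proj₁ (next (proj₁ (next t))) ≢ t
    next²≢id t e = bridge tree (proj₂ isTree) (proj₁ (proj₂ (next t))) (Star⇒Walk tree
      -- The route is `t′`, `centre t`, the crossing, `centre t′`, `t`; its first half avoids `t`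
      -- and its second half avoids `t′`.
      (   Star.map inj₁ (proj₂ (proj₂ (next t)) ◅◅ Star.reverse (Avoiding-sym tree t) (fromRow t (node-row (r t) (c t′))))
       ◅◅ Star.map inj₂ (fromCol t′ (node-col (r t) (c t′)) ◅◅ Star.reverse (Avoiding-sym tree t′) back)))
      where
      t′ = proj₁ (next t)

      back : Star (Avoiding tree t′) t (centre t′)
      back = subst (λ s → Star (Avoiding tree t′) s (centre t′)) e (proj₂ (proj₂ (next t′)))

    no-crossing-lines : Fin K → ⊥
    no-crossing-lines i = FunctionalGraph.¬vertex tree (proj₂ isTree) (proj₁ ∘ next) (proj₁ ∘ proj₂ ∘ next)
      next²≢id (node i i)

-- Sums of natural numbers over strips and blocks.

module NatSums where
  open import Data.Nat.Base

  Σ< : ℕ → (ℕ → ℕ) → ℕ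
  Σ< zero    f = 0
  Σ< (suc n) f = f 0 + Σ< n (f ∘ suc)

  Σ<-cong : ∀ n {f g : ℕ → ℕ} → (∀ x → f x ≡ g x) → Σ< n f ≡ Σ< n g
  Σ<-cong zero    e = refl
  Σ<-cong (suc n) e = cong₂ _+_ (e 0) (Σ<-cong n (e ∘ suc))

  Σ<-lower : ∀ n {f c} → (∀ {x} → x < n → c ≤ f x) → n * c ≤ Σ< n f
  Σ<-lower zero    le = z≤n
  Σ<-lower (suc n) le = ℕₚ.+-mono-≤ (le z<s) (Σ<-lower n (le ∘ s<s))

  Σ<-term : ∀ n {f x} → x < n → f x ≤ Σ< n f
  Σ<-term (suc n) {f} {zero}  _         = ℕₚ.m≤m+n (f 0) _
  Σ<-term (suc n) {f} {suc x} (s≤s x<n) = ℕₚ.≤-trans (Σ<-term n {f ∘ suc} x<n) (ℕₚ.m≤n+m _ (f 0))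

  Σ<-+ : ∀ n (f g : ℕ → ℕ) → Σ< n (λ x → f x + g x) ≡ Σ< n f + Σ< n g
  Σ<-+ zero    f g = refl
  Σ<-+ (suc n) f g = trans (cong (f 0 + g 0 +_) (Σ<-+ n (f ∘ suc) (g ∘ suc))) (interchange (f 0) (g 0) _ _)
    where
    interchange : ∀ a b c d → a + b + (c + d) ≡ a + c + (b + d)
    interchange = solve-∀

  Σ<-zero : ∀ n → Σ< n (λ _ → 0) ≡ 0
  Σ<-zero zero    = refl
  Σ<-zero (suc n) = Σ<-zero n

  Σ<-swap : ∀ m n (f : ℕ → ℕ → ℕ) → Σ< m (λ x → Σ< n (f x)) ≡ Σ< n (λ y → Σ< m (λ x → f x y))
  Σ<-swap zero    n f = sym (Σ<-zero n)
  Σ<-swap (suc m) n f = trans (cong (Σ< n (f 0) +_) (Σ<-swap m n (f ∘ suc))) (sym (Σ<-+ n (f 0) _))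

  Σ<-split : ∀ m n f → Σ< (m + n) f ≡ Σ< m f + Σ< n (λ x → f (m + x))
  Σ<-split zero    n f = refl
  Σ<-split (suc m) n f = trans (cong (f 0 +_) (Σ<-split m n (f ∘ suc))) (sym (ℕₚ.+-assoc (f 0) _ _))

  Σ<-blocks : ∀ q m f → Σ< (q * m) f ≡ Σ< q (λ p → Σ< m (λ u → f (p * m + u)))
  Σ<-blocks zero    m f = refl
  Σ<-blocks (suc q) m f = trans (Σ<-split m (q * m) f) (cong (Σ< m f +_)
    (trans (Σ<-blocks q m (λ x → f (m + x)))
      (Σ<-cong q λ p → Σ<-cong m λ u → cong f (sym (ℕₚ.+-assoc m (p * m) u)))))

  Σ<-pad : ∀ {m n} f → m ≤ n → Σ< m f ≤ Σ< n f
  Σ<-pad {m} f m≤n with k , refl ← ℕₚ.m≤n⇒∃[o]m+o≡n m≤n =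
    subst (Σ< m f ≤_) (sym (Σ<-split m k f)) (ℕₚ.m≤m+n _ _)

  -- One line out of the first half of each of K strips of 2h consecutive
  -- lines, so that the chosen lines are more than h apart.
  Selection : (K h : ℕ) → (ℕ → Set) → Set
  Selection K h P = ∀ {s} → s < K → ∃[ r ] (r < h × P (s * (2 * h) + r))

  selected< : ∀ {K h s r} → s < K → r < h → s * (2 * h) + r < K * (2 * h)
  selected< {K} {h} {s} {r} s<K r<h = begin-strict
    s * (2 * h) + r      <⟨ ℕₚ.+-monoʳ-< (s * (2 * h)) (ℕₚ.<-≤-trans r<h (ℕₚ.m≤n*m h 2)) ⟩
    s * (2 * h) + 2 * h  ≡⟨ ℕₚ.+-comm (s * (2 * h)) (2 * h) ⟩
    suc s * (2 * h)      ≤⟨ ℕₚ.*-monoˡ-≤ (2 * h) s<K ⟩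
    K * (2 * h)          ∎
    where open ℕₚ.≤-Reasoning

  -- A strip without a zero in its first half already contributes `h` to the sum.
  select : ∀ K h (f : ℕ → ℕ) → h ≤ Σ< (K * (2 * h)) f ⊎ Selection K h (λ x → f x ≡ 0)
  select K h f with ℕₚ.anyUpTo? (λ s → ¬? (good? s)) K
    where
    good? : ∀ s → Dec (∃[ r ] (r < h × f (s * (2 * h) + r) ≡ 0))
    good? s = ℕₚ.anyUpTo? (λ r → f (s * (2 * h) + r) ℕₚ.≟ 0) h
  ... | no ¬bad = inj₂ λ {s} s<K → decidable-stable
          (ℕₚ.anyUpTo? (λ r → f (s * (2 * h) + r) ℕₚ.≟ 0) h) (λ ¬good → ¬bad (s , s<K , ¬good))
  ... | yes (s , s<K , ¬good) = inj₁ (begin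
    h                                                    ≡⟨ ℕₚ.*-identityʳ h ⟨
    h * 1                                                ≤⟨ Σ<-lower h (λ r<h → ℕₚ.n≢0⇒n>0 (λ e → ¬good (_ , r<h , e))) ⟩
    Σ< h (λ r → f (s * (2 * h) + r))                     ≤⟨ Σ<-pad (λ r → f (s * (2 * h) + r)) (ℕₚ.m≤n*m h 2) ⟩
    Σ< (2 * h) (λ r → f (s * (2 * h) + r))               ≤⟨ Σ<-term K {λ p → Σ< (2 * h) (λ r → f (p * (2 * h) + r))} s<K ⟩
    Σ< K (λ p → Σ< (2 * h) (λ r → f (p * (2 * h) + r)))  ≡⟨ Σ<-blocks K (2 * h) f ⟨
    Σ< (K * (2 * h)) f                                   ∎)
    where open ℕₚ.≤-Reasoning

  Σ<≡0⇒≡0 : ∀ n {f} → Σ< n f ≡ 0 → ∀ {x} → x < n → f x ≡ 0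
  Σ<≡0⇒≡0 n {f} e x<n = ℕₚ.n≤0⇒n≡0 (subst (_ ≤_) e (Σ<-term n {f} x<n))

  -- The interface between the counting and the bramble argument: `g` will count the long edges at a
  -- vertex, and `(a , b)` is the corner of a block.
  NoClearGrid : (K h : ℕ) (g : ℕ → ℕ → ℕ) (a b : ℕ) → Set
  NoClearGrid K h g a b =
    Selection K h (λ x → ∀ {y} → y < K * (2 * h) → g (a + x) (b + y) ≡ 0) →
    Selection K h (λ y → ∀ {x} → x < K * (2 * h) → g (a + x) (b + y) ≡ 0) → ⊥

  -- `select` is applied to the row sums and to the column sums; both cannot yield a selection.
  block-bound : ∀ K h g a b → NoClearGrid K h g a b →
    h ≤ Σ< (K * (2 * h)) (λ x → Σ< (K * (2 * h)) (λ y → g (a + x) (b + y)))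
  block-bound K h g a b impossible
    with select K h (λ x → Σ< (K * (2 * h)) (λ y → g (a + x) (b + y)))
       | select K h (λ y → Σ< (K * (2 * h)) (λ x → g (a + x) (b + y)))
  ... | inj₁ le  | _        = le
  ... | inj₂ _   | inj₁ le  = subst (h ≤_) (Σ<-swap m m (λ y x → g (a + x) (b + y))) le
    where m = K * (2 * h)
  ... | inj₂ row | inj₂ col = ⊥-elim (impossible
    (λ s<K → let r , r<h , e = row s<K in r , r<h , λ {y} y<m → Σ<≡0⇒≡0 m {λ y → g (a + _) (b + y)} e y<m)
    (λ s<K → let r , r<h , e = col s<K in r , r<h , λ {x} x<m → Σ<≡0⇒≡0 m {λ x → g (a + x) (b + _)} e x<m))
    where m = K * (2 * h)

  grid-bound : ∀ K h q g → let m = K * (2 * h) in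
    (∀ {p p′} → p < q → p′ < q → NoClearGrid K h g (p * m) (p′ * m)) →
    q * (q * h) ≤ Σ< (q * m) (λ x → Σ< (q * m) (g x))
  grid-bound K h q g impossible = begin
    q * (q * h)
      ≤⟨ Σ<-lower q (λ p<q → Σ<-lower q (λ p′<q → block-bound K h g _ _ (impossible p<q p′<q))) ⟩
    Σ< q (λ p → Σ< q (λ p′ → Σ< m (λ x → Σ< m (λ y → g (p * m + x) (p′ * m + y)))))
      ≡⟨ Σ<-cong q (λ p → Σ<-swap q m (λ p′ x → Σ< m (λ y → g (p * m + x) (p′ * m + y)))) ⟩
    Σ< q (λ p → Σ< m (λ x → Σ< q (λ p′ → Σ< m (λ y → g (p * m + x) (p′ * m + y)))))
      ≡⟨ Σ<-cong q (λ p → Σ<-cong m (λ x → sym (Σ<-blocks q m (g (p * m + x))))) ⟩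
    Σ< q (λ p → Σ< m (λ x → Σ< (q * m) (g (p * m + x))))
      ≡⟨ Σ<-blocks q m (λ x → Σ< (q * m) (g x)) ⟨
    Σ< (q * m) (λ x → Σ< (q * m) (g x)) ∎
    where
    open ℕₚ.≤-Reasoning
    m = K * (2 * h)

-- Order and arithmetic of the reals.

module RealProperties (ℝ : Reals) where
  open Reals ℝ
  private
    module F = HeytingField heytingField
  module R = CommutativeRing (HeytingCommutativeRing.commutativeRing heytingCommutativeRing)
  module P = RingProperties R.ring
  open CommutativeMonoidMult R.+-commutativeMonoid public
    using () renaming (×-congʳ to ·-congʳ; ×-homo-+ to ·-homo-+; ×-assocˡ to ·-assocˡ; ×-distrib-+ to ·-distrib-+)
  open SemiringMult R.semiring public
    using () renaming (×-comm-* to ·-comm-*; ×-assoc-* to ·-assoc-*)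
  open CommutativeSemigroupProperties (R.+-commutativeSemigroup) public using () renaming (interchange to +-interchange)
  open IsStrictPartialOrder isStrictPartialOrder public
    using (<-respʳ-≈; <-respˡ-≈) renaming (irrefl to <-irrefl; trans to <-trans)

  -- This takes the place of trichotomy: as `_≤_` is a negated `_<_`, its transitivity rests on it.
  <-cotrans : ∀ {x y} → x < y → ∀ z → x < z ⊎ z < y
  <-cotrans {x} {y} x<y z with F.#-cotrans (Equivalence.from (#⇔<⊎> x y) (inj₁ x<y)) z
  ... | inj₁ x#z with Equivalence.to (#⇔<⊎> x z) x#z
  ...   | inj₁ x<z = inj₁ x<z
  ...   | inj₂ z<x = inj₂ (<-trans z<x x<y)
  <-cotrans {x} {y} x<y z | inj₂ z#y with Equivalence.to (#⇔<⊎> z y) z#y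
  ...   | inj₁ z<y = inj₂ z<y
  ...   | inj₂ y<z = inj₁ (<-trans x<y y<z)

  ≤-reflexive : ∀ {x y} → x ≈ y → x ≤ y
  ≤-reflexive e y<x = <-irrefl (R.sym e) y<x

  ≤-refl : ∀ {x} → x ≤ x
  ≤-refl = ≤-reflexive R.refl

  ≤-trans : ∀ {x y z} → x ≤ y → y ≤ z → x ≤ z
  ≤-trans {y = y} x≤y y≤z z<x with <-cotrans z<x y
  ... | inj₁ z<y = y≤z z<y
  ... | inj₂ y<x = x≤y y<x

  ≤-<-trans : ∀ {x y z} → x ≤ y → y < z → x < z
  ≤-<-trans {x} x≤y y<z with <-cotrans y<z x
  ... | inj₁ y<x = contradiction y<x x≤y
  ... | inj₂ x<z = x<z

  <⇒≤ : ∀ {x y} → x < y → x ≤ y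
  <⇒≤ x<y y<x = <-irrefl R.refl (<-trans x<y y<x)

  ≤-antisym : ∀ {x y} → x ≤ y → y ≤ x → x ≈ y
  ≤-antisym {x} {y} x≤y y≤x = proj₁ (F.tight x y) (case ∘ Equivalence.to (#⇔<⊎> x y))
    where
    case : ¬ (x < y ⊎ y < x)
    case (inj₁ x<y) = y≤x x<y
    case (inj₂ y<x) = x≤y y<x

  ≤-preorder : Preorder _ _ _
  ≤-preorder = record
    { _≈_ = _≈_ ; _≲_ = _≤_
    ; isPreorder = record { isEquivalence = R.isEquivalence ; reflexive = ≤-reflexive ; trans = ≤-trans } }

  module ≤-Reasoning = PreorderReasoning ≤-preorder

  +-cancelˡ-< : ∀ z {x y} → z + x < z + y → x < y
  +-cancelˡ-< z lt = <-respˡ-≈ (P.\\-leftDividesʳ z _) (<-respʳ-≈ (P.\\-leftDividesʳ z _) (+-monoˡ-< (- z) _ _ lt))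

  +-monoʳ-≤ : ∀ z {x y} → x ≤ y → z + x ≤ z + y
  +-monoʳ-≤ z x≤y lt = x≤y (+-cancelˡ-< z lt)

  +-mono-≤ : ∀ {w x y z} → w ≤ x → y ≤ z → w + y ≤ x + z
  +-mono-≤ {w} {x} {y} {z} w≤x y≤z = ≤-trans (+-monoʳ-≤ w y≤z)
    (≤-trans (≤-reflexive (R.+-comm w z)) (≤-trans (+-monoʳ-≤ z w≤x) (≤-reflexive (R.+-comm z x))))

  +-mono-<-≤ : ∀ {w x y z} → w < x → y ≤ z → w + y < x + z
  +-mono-<-≤ {w} {x} {y} {z} w<x y≤z =
    ≤-<-trans (+-monoʳ-≤ w y≤z) (<-respˡ-≈ (R.+-comm z w) (<-respʳ-≈ (R.+-comm z x) (+-monoˡ-< z w x w<x)))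

  x≤x+y : ∀ {x y} → 0# ≤ y → x ≤ x + y
  x≤x+y {x} 0≤y = ≤-trans (≤-reflexive (R.sym (R.+-identityʳ x))) (+-monoʳ-≤ x 0≤y)

  x≤y+x : ∀ {x y} → 0# ≤ y → x ≤ y + x
  x≤y+x 0≤y = ≤-trans (x≤x+y 0≤y) (≤-reflexive (R.+-comm _ _))

  x≤0⇐x<ε : ∀ {x} → (∀ ε → 0# < ε → x < ε) → x ≤ 0#
  x≤0⇐x<ε {x} x<ε 0<x = <-irrefl R.refl (x<ε x 0<x)

  x-y≤0⇒x≤y : ∀ {x y} → x - y ≤ 0# → x ≤ y
  x-y≤0⇒x≤y {x} {y} le = ≤-trans (≤-reflexive (R.sym (P.//-rightDividesˡ y x)))
    (≤-trans (+-mono-≤ le ≤-refl) (≤-reflexive (R.+-identityˡ y)))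

  ·-monoʳ-≤ : ∀ n {x y} → x ≤ y → n · x ≤ n · y
  ·-monoʳ-≤ zero    x≤y = ≤-refl
  ·-monoʳ-≤ (suc n) x≤y = +-mono-≤ x≤y (·-monoʳ-≤ n x≤y)

  ·-monoʳ-< : ∀ n {x y} → x < y → suc n · x < suc n · y
  ·-monoʳ-< n x<y = +-mono-<-≤ x<y (·-monoʳ-≤ n (<⇒≤ x<y))

  ·-cancelˡ-≤ : ∀ n .{{_ : ℕ.NonZero n}} {x y} → n · x ≤ n · y → x ≤ y
  ·-cancelˡ-≤ (suc n) le y<x = le (·-monoʳ-< n y<x)

  ·-zeroʳ : ∀ n → n · 0# ≈ 0#
  ·-zeroʳ zero    = R.refl
  ·-zeroʳ (suc n) = R.trans (R.+-identityˡ _) (·-zeroʳ n)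

  0≤n·x : ∀ n {x} → 0# ≤ x → 0# ≤ n · x
  0≤n·x n 0≤x = ≤-trans (≤-reflexive (R.sym (·-zeroʳ n))) (·-monoʳ-≤ n 0≤x)

  ·-monoˡ-≤ : ∀ {m n x} → 0# ≤ x → m ℕ.≤ n → m · x ≤ n · x
  ·-monoˡ-≤ {n = n} 0≤x z≤n   = 0≤n·x n 0≤x
  ·-monoˡ-≤ 0≤x (s≤s m≤n)     = +-mono-≤ ≤-refl (·-monoˡ-≤ 0≤x m≤n)

  0≤1 : 0# ≤ 1#
  0≤1 = <⇒≤ 0<1

  0≤n·1 : ∀ n → 0# ≤ n · 1#
  0≤n·1 n = 0≤n·x n 0≤1

  0<suc-n·1 : ∀ n → 0# < suc n · 1#
  0<suc-n·1 n = <-respˡ-≈ (R.+-identityʳ 0#) (+-mono-<-≤ 0<1 (0≤n·1 n))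

  ·1-cancel-≤ : ∀ {m n} → m · 1# ≤ n · 1# → m ℕ.≤ n
  ·1-cancel-≤ {m} {n} le with m ℕₚ.≤? n
  ... | yes m≤n = m≤n
  ... | no  m≰n with k , refl ← ℕₚ.m≤n⇒∃[o]m+o≡n (ℕₚ.≰⇒> m≰n) = contradiction
    (<-respˡ-≈ (R.+-identityˡ _) (<-respʳ-≈ (R.trans (R.+-comm _ _) (R.sym (eq k))) (+-mono-<-≤ (0<suc-n·1 k) ≤-refl))) le
    where
    eq : ∀ k → suc (n ℕ.+ k) · 1# ≈ n · 1# + suc k · 1#
    eq k = R.trans (R.reflexive (cong (_· 1#) (sym (ℕₚ.+-suc n k)))) (·-homo-+ 1# n (suc k))

  nat-inverse : ∀ n .{{_ : ℕ.NonZero n}} → ∃[ c ] (0# < c × c * (n · 1#) ≈ 1#)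
  nat-inverse (suc n) = c , c-pos , c*N≈1
    where
    N = suc n · 1#

    -- What gets inverted is the difference `N - 0#`, hence the corrections by `x-0≈x`.
    inv = F.#⇒invertible (Equivalence.from (#⇔<⊎> N 0#) (inj₂ (0<suc-n·1 n)))

    c = proj₁ inv

    c*N≈1 : c * N ≈ 1#
    c*N≈1 = R.trans (R.*-congˡ (R.sym (HeytingProperties.x-0≈x heytingCommutativeRing N))) (proj₁ (proj₂ inv))

    c#0 : c # 0#
    c#0 = F.invertible⇒# (N , R.trans (R.*-congˡ c-0≈c) (R.trans (R.*-comm N c) c*N≈1)
                            , R.trans (R.*-congʳ c-0≈c) c*N≈1)
      where c-0≈c = HeytingProperties.x-0≈x heytingCommutativeRing c

    c-pos : 0# < c
    c-pos with Equivalence.to (#⇔<⊎> c 0#) c#0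
    ... | inj₂ 0<c = 0<c
    -- A negative `c` would make `suc n · c`, which equals `1#`, negative.
    ... | inj₁ c<0 = ⊥-elim (<⇒≤ 0<1 (<-respˡ-≈ c*1≈ (<-respʳ-≈ (·-zeroʳ (suc n)) (·-monoʳ-< n c<0))))
      where
      c*1≈ : suc n · c ≈ 1#
      c*1≈ = R.trans (·-congʳ (suc n) (R.sym (R.*-identityʳ c))) (R.trans (R.sym (·-comm-* (suc n) c 1#)) c*N≈1)

  divide-≤ : ∀ n .{{_ : ℕ.NonZero n}} {c x y} → c * (n · 1#) ≈ 1# → x ≤ n · y → c * x ≤ y
  divide-≤ (suc n) {c} {x} {y} c*N≈1 le y<c*x = le (<-respʳ-≈ eq (·-monoʳ-< n y<c*x))
    where
    open import Relation.Binary.Reasoning.Setoid R.setoid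
    eq : suc n · (c * x) ≈ x
    eq = begin
      suc n · (c * x)        ≈⟨ ·-assoc-* (suc n) c x ⟨
      (suc n · c) * x        ≈⟨ R.*-congʳ (·-congʳ (suc n) (R.*-identityʳ c)) ⟨
      (suc n · (c * 1#)) * x ≈⟨ R.*-congʳ (·-comm-* (suc n) c 1#) ⟨
      c * (suc n · 1#) * x   ≈⟨ R.*-congʳ c*N≈1 ⟩
      1# * x                 ≈⟨ R.*-identityˡ x ⟩
      x                      ∎

  Σᴸ : ∀ {A : Set} → (A → Carrier) → List A → Carrier
  Σᴸ f []       = 0#
  Σᴸ f (a ∷ as) = f a + Σᴸ f as

  Σᴸ-mono : ∀ {A : Set} {f g : A → Carrier} {as} → All (λ a → f a ≤ g a) as → Σᴸ f as ≤ Σᴸ g as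
  Σᴸ-mono []         = ≤-refl
  Σᴸ-mono (le ∷ les) = +-mono-≤ le (Σᴸ-mono les)

  Σᴸ-cong : ∀ {A : Set} {f g : A → Carrier} → (∀ a → f a ≈ g a) → ∀ as → Σᴸ f as ≈ Σᴸ g as
  Σᴸ-cong e []       = R.refl
  Σᴸ-cong e (a ∷ as) = R.+-cong (e a) (Σᴸ-cong e as)

  Σᴸ-+ : ∀ {A : Set} (f g : A → Carrier) as → Σᴸ (λ a → f a + g a) as ≈ Σᴸ f as + Σᴸ g as
  Σᴸ-+ f g []       = R.sym (R.+-identityʳ 0#)
  Σᴸ-+ f g (a ∷ as) = R.trans (R.+-congˡ (Σᴸ-+ f g as)) (+-interchange (f a) (g a) _ _)

  Σᴸ-zero : ∀ {A : Set} (as : List A) → Σᴸ (λ _ → 0#) as ≈ 0#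
  Σᴸ-zero []       = R.refl
  Σᴸ-zero (a ∷ as) = R.trans (R.+-identityˡ _) (Σᴸ-zero as)

  Σᴸ-· : ∀ {A : Set} n (f : A → Carrier) as → Σᴸ (λ a → n · f a) as ≈ n · Σᴸ f as
  Σᴸ-· n f []       = R.sym (·-zeroʳ n)
  Σᴸ-· n f (a ∷ as) = R.trans (R.+-congˡ (Σᴸ-· n f as)) (R.sym (·-distrib-+ (f a) _ n))

  Σᴸ-const : ∀ {A : Set} x (as : List A) → Σᴸ (λ _ → x) as ≈ length as · x
  Σᴸ-const x []       = R.refl
  Σᴸ-const x (a ∷ as) = R.+-congˡ (Σᴸ-const x as)

-- Probabilities, counts of events and expectations.

module Probability (ℝ : Reals) {Ω : Set₁} (μ : Metric.ProbabilityMeasure ℝ Ω) where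
  open Reals ℝ
  open Metric ℝ
  open RealProperties ℝ
  open ProbabilityMeasure μ

  sum-≥0 : ∀ n {f : Fin n → Carrier} → (∀ i → 0# ≤ f i) → 0# ≤ sum f
  sum-≥0 zero    le = ≤-refl
  sum-≥0 (suc n) le = ≤-trans (sum-≥0 n (le ∘ Fin.suc)) (x≤y+x (le Fin.zero))

  sum-≈0 : ∀ n {f : Fin n → Carrier} → (∀ i → f i ≈ 0#) → sum f ≈ 0#
  sum-≈0 zero    e = R.refl
  sum-≈0 (suc n) e = R.trans (R.+-cong (e Fin.zero) (sum-≈0 n (e ∘ Fin.suc))) (R.+-identityˡ 0#)

  -- An empty event is the disjoint union of countably many copies of itself, so the multiples of
  -- `p` converge to `p`. For positive `p`, a partial sum of at least two terms exceeds `p` by at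
  -- least `p`, which contradicts convergence at `ε = p`.
  prob-empty : ∀ {A} (a : Event A) → (∀ ω → ¬ A ω) → prob a ≈ 0#
  prob-empty {A} a ¬A = ≤-antisym ≤0 (prob-≥0 a)
    where
    p = prob a

    ≤0 : p ≤ 0#
    ≤0 0<p with σ-additive {λ _ → A} (λ _ → a) a (λ _ _ _ (x , _) → ¬A _ x)
                 (λ ω → mk⇔ (λ _ (_ , x) → ¬A ω x) (λ _ → ¬A ω)) p 0<p
    ... | N , close = ≤-trans (x≤x+y (sum-≥0 N (λ _ → prob-≥0 a))) (≤-reflexive (R.sym eq))
                        (proj₁ (close (suc (suc N)) (ℕₚ.m≤n⇒m≤1+n (ℕₚ.n≤1+n N))))
      where
      eq : ∀ {y} → (p + y) - p ≈ y
      eq {y} = R.trans (R.+-congʳ (R.+-comm p y)) (P.//-rightDividesʳ p y)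

  -- σ-additivity for the sequence A, B, ∅, ∅, …
  prob-split : ∀ {A B C} (a : Event A) (b : Event B) (c : Event C) → A disjointFrom B →
    (∀ ω → A ω → C ω) → (∀ ω → B ω → C ω) → (∀ ω → C ω → ¬ A ω → ¬ ¬ B ω) →
    prob c ≈ prob a + prob b
  prob-split {A} {B} {C} a b c A⊥B A⊆C B⊆C C⊆A∪B = ≤-antisym
    (x-y≤0⇒x≤y (x≤0⇐x<ε λ ε 0<ε →
      let N , close = has-sum ε 0<ε
      in <-respˡ-≈ (R.+-congˡ (R.-‿cong (partial N))) (proj₂ (close _ (N≤2+N N)))))
    (x-y≤0⇒x≤y (x≤0⇐x<ε λ ε 0<ε →
      let N , close = has-sum ε 0<ε
      in <-respˡ-≈ (R.+-congʳ (partial N)) (proj₁ (close _ (N≤2+N N)))))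
    where
    seq : ℕ → Pred Ω 0ℓ
    seq 0             = A
    seq 1             = B
    seq (suc (suc _)) = ∁ U

    event : ∀ i → Event (seq i)
    event 0             = a
    event 1             = b
    event (suc (suc _)) = event-∁ event-U

    disjoint : ∀ i j → i ≢ j → seq i disjointFrom seq j
    disjoint 0             0             i≢j _       = i≢j refl
    disjoint 0             1             _   x       = A⊥B x
    disjoint 1             0             _   (x , y) = A⊥B (y , x)
    disjoint 1             1             i≢j _       = i≢j refl
    disjoint (suc (suc _)) _             _   (x , _) = x _
    disjoint 0             (suc (suc _)) _   (_ , y) = y _
    disjoint 1             (suc (suc _)) _   (_ , y) = y _

    -- `_≋_` compares only complements, so a doubly negated covering of `C` suffices.
    union : C ≋ ⋃ ℕ seq
    union ω = mk⇔
      (λ ¬C → λ where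
        (0 , x)           → ¬C (A⊆C ω x)
        (1 , x)           → ¬C (B⊆C ω x)
        (suc (suc _) , x) → x _)
      (λ ¬∪ x → C⊆A∪B ω x (¬∪ ∘ (0 ,_)) (¬∪ ∘ (1 ,_)))

    has-sum = σ-additive event c disjoint union

    N≤2+N : ∀ N → N ℕ.≤ suc (suc N)
    N≤2+N N = ℕₚ.m≤n⇒m≤1+n (ℕₚ.n≤1+n N)

    partial : ∀ N → sum {suc (suc N)} (λ i → prob (event (toℕ i))) ≈ prob a + prob b
    partial N = R.+-congˡ (R.trans (R.+-congˡ (sum-≈0 N (λ _ → prob-empty (event-∁ event-U) (λ _ x → x _))))
                                   (R.+-identityʳ (prob b)))

  -- `B` splits into `A` and the empty event. In particular `prob` does not depend on the proof that
  -- a predicate is an event.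
  prob-cong : ∀ {A B} (a : Event A) (b : Event B) → (∀ ω → A ω → B ω) → (∀ ω → B ω → A ω) → prob a ≈ prob b
  prob-cong a b A⊆B B⊆A = R.sym (R.trans
    (prob-split a (event-∁ event-U) b (λ (_ , x) → x _) A⊆B (λ _ x → ⊥-elim (x _)) (λ ω x ¬x _ → ¬x (B⊆A ω x)))
    (R.trans (R.+-congˡ (prob-empty (event-∁ event-U) (λ _ x → x _))) (R.+-identityʳ _)))

  -- De Morgan, with the union of the sequence `∁ A`, `∁ B`, `∁ B` and so on.
  event-∩ : ∀ {A B} → Event A → Event B → Event (A ∩ B)
  event-∩ {A} {B} a b = event-resp
    (λ ω → mk⇔ (λ ¬¬∪ (x , y) → ¬¬∪ λ where
                  (zero  , ¬x) → ¬x x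
                  (suc _ , ¬y) → ¬y y)
               (λ ¬∩ ¬∪ → ¬∪ (zero , λ x → ¬∪ (suc zero , λ y → ¬∩ (x , y)))))
    (event-∁ (event-⋃ event))
    where
    seq : ℕ → Pred Ω 0ℓ
    seq zero    = ∁ A
    seq (suc _) = ∁ B

    event : ∀ i → Event (seq i)
    event zero    = event-∁ a
    event (suc _) = event-∁ b

  module _ {I : Set} (A : I → Pred Ω 0ℓ) (event : ∀ i → Event (A i)) where

    -- Membership in A i is not decidable, so the number of events that
    -- occur at ω is a relation.
    data Count (ω : Ω) : List I → ℕ → Set where
      []   : Count ω [] 0
      hit  : ∀ {i is v} → A i ω → Count ω is v → Count ω (i ∷ is) (suc v)
      miss : ∀ {i is v} → ¬ A i ω → Count ω is v → Count ω (i ∷ is) v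

    -- Linearity of expectation for the number of events, proved without integrating it. `D` is
    -- split by whether the first event occurs: where it does, `pred b` of the others must still
    -- occur, and elsewhere `b` of them. The localisation to `D` makes this induction possible.
    count-bound-on : ∀ is b {D} (d : Event D) → (∀ ω → D ω → ∀ {v} → Count ω is v → b ℕ.≤ v) →
      b · prob d ≤ Σᴸ (λ i → prob (event-∩ (event i) d)) is
    count-bound-on [] zero    d le = ≤-refl
    count-bound-on [] (suc b) d le = ≤-reflexive
      (R.trans (·-congʳ (suc b) (prob-empty d (λ ω x → ℕₚ.<⇒≱ (s≤s z≤n) (le ω x [])))) (·-zeroʳ (suc b)))
    count-bound-on (i ∷ is) b {D} d le = begin
      b · prob d
        ≈⟨ ·-congʳ b (split d) ⟩
      b · (prob d₁ + prob d₀)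
        ≈⟨ ·-distrib-+ _ _ b ⟩
      b · prob d₁ + b · prob d₀
        ≲⟨ +-mono-≤ (pred-· b) ≤-refl ⟩
      (prob d₁ + ℕ.pred b · prob d₁) + b · prob d₀
        ≈⟨ R.+-assoc _ _ _ ⟩
      prob d₁ + (ℕ.pred b · prob d₁ + b · prob d₀)
        ≲⟨ +-monoʳ-≤ _ (+-mono-≤
             (count-bound-on is (ℕ.pred b) d₁ (λ ω (x , y) c → ℕₚ.pred-mono-≤ (le ω y (hit x c))))
             (count-bound-on is b d₀ (λ ω (¬x , y) c → le ω y (miss ¬x c)))) ⟩
      prob d₁ + (Σᴸ (λ j → prob (event-∩ (event j) d₁)) is + Σᴸ (λ j → prob (event-∩ (event j) d₀)) is)
        ≈⟨ R.+-congˡ (Σᴸ-+ _ _ is) ⟨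
      prob d₁ + Σᴸ (λ j → prob (event-∩ (event j) d₁) + prob (event-∩ (event j) d₀)) is
        ≈⟨ R.+-congˡ (Σᴸ-cong (λ j → split-∩ (event j)) is) ⟨
      prob d₁ + Σᴸ (λ j → prob (event-∩ (event j) d)) is ∎
      where
      open ≤-Reasoning
      d₁ = event-∩ (event i) d
      d₀ = event-∩ (event-∁ (event i)) d

      split : (d : Event D) → prob d ≈ prob d₁ + prob d₀
      split d = prob-split d₁ d₀ d (λ ((x , _) , (¬x , _)) → ¬x x) (λ _ → proj₂) (λ _ → proj₂)
        (λ ω y ¬₁ ¬₀ → ¬₀ ((λ x → ¬₁ (x , y)) , y))

      split-∩ : ∀ {B} (b : Event B) →
        prob (event-∩ b d) ≈ prob (event-∩ b d₁) + prob (event-∩ b d₀)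
      split-∩ b = prob-split (event-∩ b d₁) (event-∩ b d₀) (event-∩ b d)
        (λ ((_ , (x , _)) , (_ , (¬x , _))) → ¬x x)
        (λ _ (z , (_ , y)) → z , y) (λ _ (z , (_ , y)) → z , y)
        (λ ω (z , y) ¬₁ ¬₀ → ¬₀ (z , (λ x → ¬₁ (z , (x , y))) , y))

      pred-· : ∀ b → b · prob d₁ ≤ prob d₁ + ℕ.pred b · prob d₁
      pred-· zero    = ≤-trans (prob-≥0 d₁) (≤-reflexive (R.sym (R.+-identityʳ _)))
      pred-· (suc b) = ≤-refl

    count-bound : ∀ is b → (∀ ω {v} → Count ω is v → b ℕ.≤ v) →
      b · 1# ≤ Σᴸ (λ i → prob (event i)) is
    count-bound is b le = begin
      b · 1#                                         ≈⟨ ·-congʳ b prob-U ⟨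
      b · prob event-U                               ≲⟨ count-bound-on is b event-U (λ ω _ → le ω) ⟩
      Σᴸ (λ i → prob (event-∩ (event i) event-U)) is
        ≈⟨ Σᴸ-cong (λ i → prob-cong (event-∩ (event i) event-U) (event i) (λ _ → proj₁) (λ _ x → x , _)) is ⟩
      Σᴸ (λ i → prob (event i)) is                   ∎
      where open ≤-Reasoning

  -- Summation by parts for doubling weights, to be used with tail probabilities `q` and their
  -- differences `p`. The weights are left general because the induction shifts all three sequences.
  abel : ∀ m (w : ℕ → ℕ) (p q : ℕ → Carrier) → (∀ i → w (suc i) ≡ 2 ℕ.* w i) → (∀ i → q i ≈ p i + q (suc i)) →
    sum {m} (λ i → w (toℕ i) · q (toℕ i)) + w 0 · q 0 ≈ 2 · sum {m} (λ i → w (toℕ i) · p (toℕ i)) + w m · q m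
  abel zero    w p q double split = R.+-congʳ (R.sym (·-zeroʳ 2))
  abel (suc m) w p q double split = begin
    (w 0 · q 0 + S) + w 0 · q 0
      ≈⟨ R.trans (R.+-congʳ (R.+-comm _ S)) (R.+-assoc S _ _) ⟩
    S + (w 0 · q 0 + w 0 · q 0)
      ≈⟨ R.+-congˡ first ⟩
    S + (w 1 · q 1 + 2 · (w 0 · p 0))
      ≈⟨ R.+-assoc S _ _ ⟨
    (S + w 1 · q 1) + 2 · (w 0 · p 0)
      ≈⟨ R.+-congʳ (abel m (w ∘ suc) (p ∘ suc) (q ∘ suc) (double ∘ suc) (split ∘ suc)) ⟩
    (2 · T + w (suc m) · q (suc m)) + 2 · (w 0 · p 0)
      ≈⟨ R.trans (R.+-comm _ _) (R.sym (R.+-assoc _ _ _)) ⟩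
    (2 · (w 0 · p 0) + 2 · T) + w (suc m) · q (suc m)
      ≈⟨ R.+-congʳ (·-distrib-+ _ T 2) ⟨
    2 · (w 0 · p 0 + T) + w (suc m) · q (suc m) ∎
    where
    open import Relation.Binary.Reasoning.Setoid R.setoid
    S = sum {m} (λ i → w (suc (toℕ i)) · q (suc (toℕ i)))
    T = sum {m} (λ i → w (suc (toℕ i)) · p (suc (toℕ i)))

    first : w 0 · q 0 + w 0 · q 0 ≈ w 1 · q 1 + 2 · (w 0 · p 0)
    first = begin
      w 0 · q 0 + w 0 · q 0                   ≈⟨ R.+-congˡ (R.+-identityʳ _) ⟨
      2 · (w 0 · q 0)                         ≈⟨ ·-congʳ 2 (·-congʳ (w 0) (split 0)) ⟩
      2 · (w 0 · (p 0 + q 1))                 ≈⟨ ·-congʳ 2 (·-distrib-+ _ _ (w 0)) ⟩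
      2 · (w 0 · p 0 + w 0 · q 1)             ≈⟨ ·-distrib-+ _ _ 2 ⟩
      2 · (w 0 · p 0) + 2 · (w 0 · q 1)       ≈⟨ R.+-comm _ _ ⟩
      2 · (w 0 · q 1) + 2 · (w 0 · p 0)       ≈⟨ R.+-congʳ (·-assocˡ (q 1) 2 (w 0)) ⟩
      (2 ℕ.* w 0) · q 1 + 2 · (w 0 · p 0)     ≡⟨ cong (λ k → k · q 1 + 2 · (w 0 · p 0)) (double 0) ⟨
      w 1 · q 1 + 2 · (w 0 · p 0)             ∎

  module _ {X : Ω → Carrier} {e : Carrier} (E : HasExpectation μ X e) where
    open HasExpectation E

    tail : ∀ i → Event (λ ω → (2 ^ i) · 1# ≤ X ω)
    tail i = measurable ((2 ^ i) · 1#)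

    -- The simple function equal to 2 ^ i where 2 ^ i ≤ X < 2 ^ (1 + i).
    dyadic : ℕ → SimpleBelow μ X
    dyadic m = record
      { event    = λ i → event-∩ (tail (toℕ i)) (event-∁ (tail (suc (toℕ i))))
      ; disjoint = disjoint
      ; value    = λ (i : Fin m) → (2 ^ toℕ i) · 1#
      ; value-≥0 = λ i → 0≤n·1 (2 ^ toℕ i)
      ; below    = λ _ _ → proj₁
      }
      where
      apart : ∀ {i j ω} → i ℕ.< j → ¬ ((2 ^ suc i) · 1# ≤ X ω) → ¬ ((2 ^ j) · 1# ≤ X ω)
      apart {i} {j} i<j ¬≤ ≤X = ¬≤ (≤-trans (·-monoˡ-≤ 0≤1 (ℕₚ.^-monoʳ-≤ 2 i<j)) ≤X)

      disjoint : ∀ (i j : Fin m) → i ≢ j → _ disjointFrom _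
      disjoint i j i≢j ((≤X , ¬≤X) , (≤X′ , ¬≤X′)) with ℕₚ.<-cmp (toℕ i) (toℕ j)
      ... | tri< i<j _ _ = apart i<j ¬≤X ≤X′
      ... | tri≈ _ i≡j _ = i≢j (Finₚ.toℕ-injective i≡j)
      ... | tri> _ _ j<i = apart j<i ¬≤X′ ≤X

    -- Its integral gives Markov's inequality, which bounds the boundary term of `abel`.
    top : ℕ → SimpleBelow μ X
    top m = record
      { event    = λ (i : Fin 1) → tail m
      ; disjoint = λ { Fin.zero Fin.zero 0≢0 → contradiction refl 0≢0 }
      ; value    = λ _ → (2 ^ m) · 1#
      ; value-≥0 = λ _ → 0≤n·1 (2 ^ m)
      ; below    = λ _ _ ≤X → ≤X
      }

    -- A layer-cake bound. By `abel` the sum is at most twice the integral of `dyadic m` plus that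
    -- of `top m`, and each integral is at most `e`.
    dyadic-tails : ∀ m → sum {m} (λ i → (2 ^ toℕ i) · prob (tail (toℕ i))) ≤ 3 · e
    dyadic-tails m = begin
      sum {m} (λ i → (2 ^ toℕ i) · q (toℕ i))                      ≲⟨ x≤x+y (0≤n·x 1 (prob-≥0 (tail 0))) ⟩
      sum {m} (λ i → (2 ^ toℕ i) · q (toℕ i)) + 1 · q 0            ≈⟨ abel m (2 ^_) p q (λ _ → refl) split ⟩
      2 · sum {m} (λ i → (2 ^ toℕ i) · p (toℕ i)) + (2 ^ m) · q m  ≲⟨ +-mono-≤ (·-monoʳ-≤ 2 low) high ⟩
      2 · e + e                                                    ≈⟨ R.+-comm _ _ ⟩
      3 · e                                                        ∎
      where
      open ≤-Reasoning
      q p : ℕ → Carrier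
      q i = prob (tail i)
      p i = prob (event-∩ (tail i) (event-∁ (tail (suc i))))

      split : ∀ i → q i ≈ p i + q (suc i)
      split i = prob-split (event-∩ (tail i) (event-∁ (tail (suc i)))) (tail (suc i)) (tail i)
        (λ ((_ , ¬≤X) , ≤X) → ¬≤X ≤X) (λ _ → proj₁)
        (λ _ → ≤-trans (·-monoˡ-≤ 0≤1 (ℕₚ.^-monoʳ-≤ 2 (ℕₚ.n≤1+n i))))
        (λ _ ≤X ¬p ¬q → ¬p (≤X , ¬q))

      scale : ∀ n x → n · x ≈ (n · 1#) * x
      scale n x = R.sym (R.trans (·-assoc-* n 1# x) (·-congʳ n (R.*-identityˡ x)))

      sum-cong : ∀ n {f g : Fin n → Carrier} → (∀ i → f i ≈ g i) → sum f ≈ sum g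
      sum-cong zero    e = R.refl
      sum-cong (suc n) e = R.+-cong (e Fin.zero) (sum-cong n (e ∘ Fin.suc))

      low : sum {m} (λ i → (2 ^ toℕ i) · p (toℕ i)) ≤ e
      low = ≤-trans (≤-reflexive (sum-cong m (λ i → scale (2 ^ toℕ i) _))) (upper (dyadic m))

      high : (2 ^ m) · q m ≤ e
      high = ≤-trans (≤-reflexive (R.trans (scale (2 ^ m) (q m)) (R.sym (R.+-identityʳ _)))) (upper (top m))

-- Distances in the grid.

module GridWalks {n : ℕ} where
  open Graph (GRID n) using (steps)

  Consecutive⇒≤ : ∀ {i j : Fin n} → Consecutive i j → toℕ j ℕ.≤ suc (toℕ i)
  Consecutive⇒≤ (inj₁ e) = ℕₚ.≤-reflexive e
  Consecutive⇒≤ (inj₂ e) = ℕₚ.m≤n⇒m≤1+n (ℕₚ.≤-trans (ℕₚ.n≤1+n _) (ℕₚ.≤-reflexive (sym e)))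

  -- Each edge raises `f` by at most one. With `f` a coordinate, this bounds grid distances from
  -- below.
  steps-≥ : (f : Fin n × Fin n → ℕ) → (∀ {u v} → Graph.Adj (GRID n) u v → f v ℕ.≤ suc (f u)) →
    ∀ {u v} (p : Walk (GRID n) u v) → f v ℕ.≤ f u ℕ.+ steps p
  steps-≥ f lip stop           = ℕₚ.m≤m+n _ 0
  steps-≥ f lip (step {u} a p) = ℕₚ.≤-trans (steps-≥ f lip p)
    (ℕₚ.≤-trans (ℕₚ.+-monoˡ-≤ (steps p) (lip a)) (ℕₚ.≤-reflexive (sym (ℕₚ.+-suc (f u) (steps p)))))

  row-lipschitz : ∀ {u v} → Graph.Adj (GRID n) u v → toℕ (proj₁ v) ℕ.≤ suc (toℕ (proj₁ u))
  row-lipschitz (inj₁ (refl , _)) = ℕₚ.n≤1+n _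
  row-lipschitz (inj₂ (c , _))    = Consecutive⇒≤ c

  col-lipschitz : ∀ {u v} → Graph.Adj (GRID n) u v → toℕ (proj₂ v) ℕ.≤ suc (toℕ (proj₂ u))
  col-lipschitz (inj₁ (_ , c))    = Consecutive⇒≤ c
  col-lipschitz (inj₂ (_ , refl)) = ℕₚ.n≤1+n _

module GridMetric (ℝ : Reals) {n : ℕ}
  (d : Metric.ShortestPathMetric ℝ (Metric.unitWeights ℝ (GRID n))) where
  open Reals ℝ
  open Metric ℝ
  open RealProperties ℝ
  open GridWalks {n}
  open ShortestPathMetric d
  open WeightedGraph (unitWeights (GRID n)) using () renaming (length to lengthᴳ)
  open Graph (GRID n) using (steps)

  length≈steps : ∀ {u v} (p : Walk (GRID n) u v) → lengthᴳ p ≈ steps p · 1#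
  length≈steps stop       = R.refl
  length≈steps (step a p) = R.+-congˡ (length≈steps p)

  dist-≥ : (f : Fin n × Fin n → ℕ) → (∀ {u v} → Graph.Adj (GRID n) u v → f v ℕ.≤ suc (f u)) →
    ∀ {c u v} → f u ℕ.+ c ℕ.≤ f v → c · 1# ≤ dist u v
  dist-≥ f lip {c} {u} {v} le = let p , e = attained u v in ≤-trans
    (·-monoˡ-≤ 0≤1 (ℕₚ.+-cancelˡ-≤ (f u) c (steps p) (ℕₚ.≤-trans le (steps-≥ f lip p))))
    (≤-reflexive (R.trans (R.sym (length≈steps p)) e))

  row-dist-≥ : ∀ {c u v} → toℕ (proj₁ u) ℕ.+ c ℕ.≤ toℕ (proj₁ v) → c · 1# ≤ dist u v
  row-dist-≥ = dist-≥ (toℕ ∘ proj₁) row-lipschitz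

  col-dist-≥ : ∀ {c u v} → toℕ (proj₂ u) ℕ.+ c ℕ.≤ toℕ (proj₂ v) → c · 1# ≤ dist u v
  col-dist-≥ = dist-≥ (toℕ ∘ proj₂) col-lipschitz

  dist-adjacent-≤ : ∀ {u v} → Graph.Adj (GRID n) u v → dist u v ≤ 1#
  dist-adjacent-≤ a = ≤-trans (shortest (step a stop)) (≤-reflexive (R.+-identityʳ 1#))

module GridVertices {n : ℕ} .{{_ : ℕ.NonZero n}} where
  -- Coordinates of at least n are junk.
  vertex : ℕ → ℕ → Fin n × Fin n
  vertex x y = x mod n , y mod n

  toℕ-mod : ∀ {x} → x ℕ.< n → toℕ (x mod n) ≡ x
  toℕ-mod {x} x<n = trans (Finₚ.toℕ-fromℕ< (m%n<n x n)) (m<n⇒m%n≡m x<n)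

-- Images of grid lines in `H`, and the exclusion of a grid of short lines.

module Lines (ℝ : Reals) {size : ℕ} (H : Metric.WeightedGraph ℝ (Fin size))
  (metric : Metric.ShortestPathMetric ℝ H) where
  open Reals ℝ
  open Metric ℝ
  open RealProperties ℝ
  open WeightedGraph H renaming (length to lengthᴴ)
  open ShortestPathMetric metric
  open Walks graph
  open Graph graph using (vertices)

  length-≥0 : ∀ {u v} (p : Walk graph u v) → 0# ≤ lengthᴴ p
  length-≥0 stop       = ≤-refl
  length-≥0 (step a p) = ≤-trans (length-≥0 p) (x≤y+x (<⇒≤ (weight-pos a)))

  length-++ : ∀ {u v w} (p : Walk graph u v) (q : Walk graph v w) →
    lengthᴴ (p ++ʷ q) ≈ lengthᴴ p + lengthᴴ q
  length-++ stop       q = R.sym (R.+-identityˡ _)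
  length-++ (step a p) q = R.trans (R.+-congˡ (length-++ p q)) (R.sym (R.+-assoc _ _ _))

  Reach : Carrier → Fin size → Fin size → Set
  Reach l u v = Σ[ p ∈ Walk graph u v ] lengthᴴ p ≤ l

  splitAt : ∀ {u v x} (p : Walk graph u v) → x ∈ vertices p → Reach (lengthᴴ p) u x × Reach (lengthᴴ p) x v
  splitAt stop       (here refl) = (stop , ≤-refl) , (stop , ≤-refl)
  splitAt (step a p) (here refl) = (stop , length-≥0 (step a p)) , (step a p , ≤-refl)
  splitAt (step a p) (there i)   = let (q , q≤) , (r , r≤) = splitAt p i in
    (step a q , +-monoʳ-≤ _ q≤) , (r , ≤-trans r≤ (x≤y+x (<⇒≤ (weight-pos a))))

  dist-via : ∀ {l u v w} → Reach l u v → Reach l v w → dist u w ≤ l + l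
  dist-via (p , p≤) (q , q≤) = ≤-trans (shortest (p ++ʷ q)) (≤-trans (≤-reflexive (length-++ p q)) (+-mono-≤ p≤ q≤))

  -- Images of adjacent grid vertices need not be adjacent in `H`, so shortest paths join them.
  lineWalk : ∀ m (pt : ℕ → Fin size) → Walk graph (pt 0) (pt m)
  lineWalk zero    pt = stop
  lineWalk (suc m) pt = proj₁ (attained (pt 0) (pt 1)) ++ʷ lineWalk m (pt ∘ suc)

  point∈lineWalk : ∀ m pt {t} → t ℕ.≤ m → pt t ∈ vertices (lineWalk m pt)
  point∈lineWalk m       pt {zero}  _         = head∈ (lineWalk m pt)
  point∈lineWalk (suc m) pt {suc t} (s≤s t≤m) =
    ∈-++ʳ (proj₁ (attained (pt 0) (pt 1))) _ (point∈lineWalk m (pt ∘ suc) t≤m)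

  -- `x` lies on a shortest path of length at most `l` between consecutive points. Walks to and from
  -- `x` are both recorded, so that none has to be reversed.
  near-point : ∀ m pt {l} → 0# ≤ l → (∀ {t} → t ℕ.< m → dist (pt t) (pt (suc t)) ≤ l) →
    ∀ {x} → x ∈ vertices (lineWalk m pt) →
    (∃[ t ] (t ℕ.≤ m × Reach l (pt t) x)) × (∃[ t ] (t ℕ.≤ m × Reach l x (pt t)))
  near-point zero    pt 0≤l short (here refl) = (0 , z≤n , stop , 0≤l) , (0 , z≤n , stop , 0≤l)
  near-point (suc m) pt 0≤l short x∈ with ∈-++⁻ (proj₁ (attained (pt 0) (pt 1))) (lineWalk m (pt ∘ suc)) x∈
  ... | inj₁ i =
    let p , e = attained (pt 0) (pt 1)
        (q , q≤) , (r , r≤) = splitAt p i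
        p≤ = ≤-trans (≤-reflexive e) (short (s≤s z≤n))
    in (0 , z≤n , q , ≤-trans q≤ p≤) , (1 , s≤s z≤n , r , ≤-trans r≤ p≤)
  ... | inj₂ i = let (t , t≤ , q) , (t′ , t′≤ , r) = near-point m (pt ∘ suc) 0≤l (short ∘ s≤s) i
    in (suc t , s≤s t≤ , q) , (suc t′ , s≤s t′≤ , r)

  -- A common vertex is within `L` of a point of either line, so these points would be at distance
  -- at most `2 * L`, one less than `far` demands.
  lines-disjoint : ∀ {K m L} (pt : Fin K → ℕ → Fin size) →
    (∀ s {t} → t ℕ.< m → dist (pt s t) (pt s (suc t)) ≤ L · 1#) →
    (∀ {s s′ t t′} → toℕ s ℕ.< toℕ s′ → t ℕ.≤ m → t′ ℕ.≤ m → suc (2 ℕ.* L) · 1# ≤ dist (pt s t) (pt s′ t′)) →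
    ∀ {s s′ x} → x ∈ vertices (lineWalk m (pt s)) → x ∈ vertices (lineWalk m (pt s′)) → s ≡ s′
  lines-disjoint {m = m} {L} pt short far {s} {s′} x∈ x∈′ = compare (ℕₚ.<-cmp (toℕ s) (toℕ s′))
    where
    meet : ∀ {s s′ x} → toℕ s ℕ.< toℕ s′ →
      x ∈ vertices (lineWalk m (pt s)) → x ∈ vertices (lineWalk m (pt s′)) → ⊥
    meet {s} {s′} s<s′ x∈ x∈′ =
      let (_ , t≤m , p) , _  = near-point m (pt s)  (0≤n·1 L) (short s)  x∈
          _ , (_ , t′≤m , q) = near-point m (pt s′) (0≤n·1 L) (short s′) x∈′
      in ℕₚ.1+n≰n (·1-cancel-≤ {n = 2 ℕ.* L} (≤-trans (far s<s′ t≤m t′≤m) (≤-trans (dist-via p q)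
           (≤-reflexive (R.trans (R.+-congˡ (R.sym (R.+-identityʳ _))) (·-assocˡ 1# 2 L))))))

    compare : _ → s ≡ s′
    compare (tri< s<s′ _ _) = ⊥-elim (meet s<s′ x∈ x∈′)
    compare (tri≈ _ s≡s′ _) = Finₚ.toℕ-injective s≡s′
    compare (tri> _ _ s′<s) = ⊥-elim (meet s′<s x∈′ x∈)

module ClearGrid (ℝ : Reals) {n : ℕ} .{{_ : ℕ.NonZero n}}
  (d : Metric.ShortestPathMetric ℝ (Metric.unitWeights ℝ (GRID n)))
  {k : ℕ} (E : Metric.DominatingEmbedding ℝ k (Metric.ShortestPathMetric.dist d)) where
  open Reals ℝ
  open Metric ℝ
  open RealProperties ℝ
  open GridMetric ℝ d
  open GridVertices {n}
  open DominatingEmbedding E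
  open Lines ℝ H metric
  open NatSums
  open Bramble (proj₁ treewidth) using (no-crossing-lines)

  module Selected (K h : ℕ) (P : ℕ → Set) (sel : Selection K h P) (a : ℕ) where
    line : Fin K → ℕ
    line s = toℕ s ℕ.* (2 ℕ.* h) ℕ.+ proj₁ (sel (Finₚ.toℕ<n s))

    holds : ∀ s → P (line s)
    holds s = proj₂ (proj₂ (sel (Finₚ.toℕ<n s)))

    -- The chosen line is in the first half of its strip, so the `h` lines of the second half follow
    -- it before strip `i` begins. Taking `i = K` bounds the line by the block.
    line-separated′ : ∀ s {i} → toℕ s ℕ.< i → suc (line s) ℕ.+ h ℕ.≤ i ℕ.* (2 ℕ.* h)
    line-separated′ s {i} s<i = begin
      suc (toℕ s ℕ.* (2 ℕ.* h) ℕ.+ r) ℕ.+ h  ≡⟨ cong (ℕ._+ h) (ℕₚ.+-suc _ r) ⟨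
      toℕ s ℕ.* (2 ℕ.* h) ℕ.+ suc r ℕ.+ h    ≤⟨ ℕₚ.+-monoˡ-≤ h (ℕₚ.+-monoʳ-≤ (toℕ s ℕ.* (2 ℕ.* h)) r<h) ⟩
      toℕ s ℕ.* (2 ℕ.* h) ℕ.+ h ℕ.+ h        ≡⟨ rearrange (toℕ s ℕ.* (2 ℕ.* h)) h ⟩
      suc (toℕ s) ℕ.* (2 ℕ.* h)              ≤⟨ ℕₚ.*-monoˡ-≤ (2 ℕ.* h) s<i ⟩
      i ℕ.* (2 ℕ.* h)                        ∎
      where
      open ℕₚ.≤-Reasoning
      r = proj₁ (sel (Finₚ.toℕ<n s))
      r<h = proj₁ (proj₂ (sel (Finₚ.toℕ<n s)))
      rearrange : ∀ x h → x ℕ.+ h ℕ.+ h ≡ 2 ℕ.* h ℕ.+ x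
      rearrange = solve-∀

    line-separated : ∀ {s s′} → toℕ s ℕ.< toℕ s′ → a ℕ.+ line s ℕ.+ suc h ℕ.≤ a ℕ.+ line s′
    line-separated {s} {s′} s<s′ = begin
      a ℕ.+ line s ℕ.+ suc h    ≡⟨ ℕₚ.+-assoc a (line s) (suc h) ⟩
      a ℕ.+ (line s ℕ.+ suc h)  ≡⟨ cong (a ℕ.+_) (ℕₚ.+-suc (line s) h) ⟩
      a ℕ.+ suc (line s ℕ.+ h)  ≤⟨ ℕₚ.+-monoʳ-≤ a (ℕₚ.≤-trans (line-separated′ s s<s′) (ℕₚ.m≤m+n _ _)) ⟩
      a ℕ.+ line s′             ∎
      where open ℕₚ.≤-Reasoning

    line< : ∀ s → line s ℕ.< K ℕ.* (2 ℕ.* h)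
    line< s = ℕₚ.≤-trans (ℕₚ.m≤m+n _ h) (line-separated′ s (Finₚ.toℕ<n s))

  module _ (L a b : ℕ) where
    private
      K = suc (suc k)
      h = 2 ℕ.* L
      m = K ℕ.* (2 ℕ.* h)

    ShortRow ShortCol : ℕ → Set
    ShortRow x = ∀ {y} → y ℕ.< m →
      stretched (vertex (a ℕ.+ x) (b ℕ.+ y)) (vertex (a ℕ.+ x) (suc (b ℕ.+ y))) ≤ L · 1#
    ShortCol y = ∀ {x} → x ℕ.< m →
      stretched (vertex (a ℕ.+ x) (b ℕ.+ y)) (vertex (suc (a ℕ.+ x)) (b ℕ.+ y)) ≤ L · 1#

    no-clear-grid : a ℕ.+ m ℕ.< n → b ℕ.+ m ℕ.< n →
      Selection K h ShortRow → Selection K h ShortCol → ⊥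
    no-clear-grid a+m<n b+m<n rows cols = no-crossing-lines
      (λ s → _ , _ , lineWalk m (rowPt s)) (λ s → _ , _ , lineWalk m (colPt s))
      (λ {s} {s′} → lines-disjoint {L = L} rowPt row-short row-far {s} {s′})
      (λ {s} {s′} → lines-disjoint {L = L} colPt col-short col-far {s} {s′})
      -- The lines share the image of the grid vertex where they cross: `rowPt i (Col.line j)` and
      -- `colPt j (Row.line i)` agree by definition.
      (λ i j → rowPt i (Col.line j)
             , point∈lineWalk m (rowPt i) (ℕₚ.<⇒≤ (Col.line< j))
             , point∈lineWalk m (colPt j) (ℕₚ.<⇒≤ (Row.line< i)))
      -- A bag has at most `suc k` vertices, one fewer than there are rows or columns.
      (λ t → s≤s (proj₂ treewidth t))
      Fin.zero
      where
      module Row = Selected K h ShortRow rows a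
      module Col = Selected K h ShortCol cols b

      row col : Fin K → ℕ
      row s = a ℕ.+ Row.line s
      col s = b ℕ.+ Col.line s

      rowPt colPt : Fin K → ℕ → Fin size
      rowPt s t = Φ (vertex (row s) (b ℕ.+ t))
      colPt s t = Φ (vertex (a ℕ.+ t) (col s))

      toℕ-row : ∀ s → row s ≡ toℕ (row s mod n)
      toℕ-row s = sym (toℕ-mod (ℕₚ.<-trans (ℕₚ.+-monoʳ-< a (Row.line< s)) a+m<n))

      toℕ-col : ∀ s → col s ≡ toℕ (col s mod n)
      toℕ-col s = sym (toℕ-mod (ℕₚ.<-trans (ℕₚ.+-monoʳ-< b (Col.line< s)) b+m<n))

      row-short : ∀ s {t} → t ℕ.< m → ShortestPathMetric.dist metric (rowPt s t) (rowPt s (suc t)) ≤ L · 1#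
      row-short s {t} t<m = subst (λ y → stretched (vertex (row s) (b ℕ.+ t)) (vertex (row s) y) ≤ L · 1#)
        (sym (ℕₚ.+-suc b t)) (Row.holds s t<m)

      col-short : ∀ s {t} → t ℕ.< m → ShortestPathMetric.dist metric (colPt s t) (colPt s (suc t)) ≤ L · 1#
      col-short s {t} t<m = subst (λ x → stretched (vertex (a ℕ.+ t) (col s)) (vertex x (col s)) ≤ L · 1#)
        (sym (ℕₚ.+-suc a t)) (Col.holds s t<m)

      row-far : ∀ {s s′ t t′} → toℕ s ℕ.< toℕ s′ → t ℕ.≤ m → t′ ℕ.≤ m →
        suc h · 1# ≤ ShortestPathMetric.dist metric (rowPt s t) (rowPt s′ t′)
      row-far {s} {s′} s<s′ _ _ = ≤-trans
        (row-dist-≥ (subst₂ (λ x y → x ℕ.+ suc h ℕ.≤ y) (toℕ-row s) (toℕ-row s′) (Row.line-separated s<s′)))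
        (dominates _ _)

      col-far : ∀ {s s′ t t′} → toℕ s ℕ.< toℕ s′ → t ℕ.≤ m → t′ ℕ.≤ m →
        suc h · 1# ≤ ShortestPathMetric.dist metric (colPt s t) (colPt s′ t′)
      col-far {s} {s′} s<s′ _ _ = ≤-trans
        (col-dist-≥ (subst₂ (λ x y → x ℕ.+ suc h ℕ.≤ y) (toℕ-col s) (toℕ-col s′) (Col.line-separated s<s′)))
        (dominates _ _)

-- The list of edges, and counts along it.

concatUpTo : ∀ {A : Set} → ℕ → (ℕ → List A) → List A
concatUpTo zero    f = []
concatUpTo (suc n) f = f 0 ++ concatUpTo n (f ∘ suc)

length-concatUpTo : ∀ {A : Set} n {f : ℕ → List A} {c} → (∀ x → length (f x) ≡ c) →
  length (concatUpTo n f) ≡ n ℕ.* c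
length-concatUpTo zero    e = refl
length-concatUpTo (suc n) {f} e =
  trans (Listₚ.length-++ (f 0)) (cong₂ ℕ._+_ (e 0) (length-concatUpTo n (e ∘ suc)))

All-concatUpTo : ∀ {A : Set} {P : A → Set} n {f : ℕ → List A} →
  (∀ {x} → x ℕ.< n → All P (f x)) → All P (concatUpTo n f)
All-concatUpTo zero    all = []
All-concatUpTo (suc n) all = Allₚ.++⁺ (all ℕ.z<s) (All-concatUpTo n (all ∘ ℕ.s<s))

module Counting (ℝ : Reals) {Ω : Set₁} (μ : Metric.ProbabilityMeasure ℝ Ω) where
  open Metric ℝ
  open Probability ℝ μ
  open ProbabilityMeasure μ
  open NatSums

  module _ {I : Set} (A : I → Pred Ω 0ℓ) (event : ∀ i → Event (A i)) where

    count-++ : ∀ {ω} is {js v} → Count A event ω (is ++ js) v →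
      ∃[ a ] ∃[ b ] (Count A event ω is a × Count A event ω js b × v ≡ a ℕ.+ b)
    count-++ []       c          = _ , _ , [] , c , refl
    count-++ (i ∷ is) (hit x c)  = let _ , _ , a , b , e = count-++ is c in _ , _ , hit x a , b , cong suc e
    count-++ (i ∷ is) (miss x c) = let _ , _ , a , b , e = count-++ is c in _ , _ , miss x a , b , e

    count-concatUpTo : ∀ {ω} n (f : ℕ → List I) {v} → Count A event ω (concatUpTo n f) v →
      ∃[ g ] ((∀ {x} → x ℕ.< n → Count A event ω (f x) (g x)) × v ≡ Σ< n g)
    count-concatUpTo zero    f [] = (λ _ → 0) , (λ ()) , refl
    count-concatUpTo {ω} (suc n) f c with count-++ (f 0) c
    ... | a , _ , ca , cb , e with count-concatUpTo n (f ∘ suc) cb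
    ...   | g , cg , refl = g′ , cg′ , e
      where
      g′ : ℕ → ℕ
      g′ zero    = a
      g′ (suc x) = g x

      cg′ : ∀ {x} → x ℕ.< suc n → Count A event ω (f x) (g′ x)
      cg′ {zero}  _         = ca
      cg′ {suc x} (s≤s x<n) = cg x<n

    -- This turns a count over all edges into a double sum of counts at single vertices, the form
    -- that `grid-bound` takes.
    count-concatUpTo² : ∀ {ω} m n (f : ℕ → ℕ → List I) {v} →
      Count A event ω (concatUpTo m (λ x → concatUpTo n (f x))) v →
      Σ[ g ∈ (ℕ → ℕ → ℕ) ] ((∀ {x y} → x ℕ.< m → y ℕ.< n → Count A event ω (f x y) (g x y)) × v ≡ Σ< m (λ x → Σ< n (g x)))
    count-concatUpTo² zero    n f [] = (λ _ _ → 0) , (λ ()) , refl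
    count-concatUpTo² {ω} (suc m) n f c with count-++ (concatUpTo n (f 0)) c
    ... | a , _ , ca , cb , e with count-concatUpTo n (f 0) ca | count-concatUpTo² m n (f ∘ suc) cb
    ...   | g₀ , cg₀ , refl | g , cg , refl = g′ , cg′ , e
      where
      g′ : ℕ → ℕ → ℕ
      g′ zero    = g₀
      g′ (suc x) = g x

      cg′ : ∀ {x y} → x ℕ.< suc m → y ℕ.< n → Count A event ω (f x y) (g′ x y)
      cg′ {zero}  _         y<n = cg₀ y<n
      cg′ {suc x} (s≤s x<m) y<n = cg x<m y<n

data Edge : Set where
  east south : ℕ → ℕ → Edge

edges : ℕ → List Edge
edges N = concatUpTo N (λ x → concatUpTo N (λ y → east x y ∷ south x y ∷ []))

length-edges : ∀ N → length (edges N) ≡ N ℕ.* (N ℕ.* 2)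
length-edges N = length-concatUpTo N (λ x → length-concatUpTo N (λ y → refl))

-- Long edges at each scale, and the sum over the scales.

module LowerBound (ℝ : Reals) {n : ℕ} .{{_ : ℕ.NonZero n}} {k : ℕ}
  (d : Metric.ShortestPathMetric ℝ (Metric.unitWeights ℝ (GRID n)))
  {α : Reals.Carrier ℝ} (approx : Metric.Approximation ℝ k (Metric.ShortestPathMetric.dist d) α) where
  open Reals ℝ
  open Metric ℝ
  open RealProperties ℝ
  open ShortestPathMetric d
  open Approximation approx
  open Probability ℝ distribution
  open Counting ℝ distribution
  open ProbabilityMeasure distribution using (prob; Event)
  open GridMetric ℝ d
  open GridVertices {n}
  open DominatingEmbedding using (stretched)
  open NatSums

  src tgt : Edge → Fin n × Fin n
  src (east x y)  = vertex x y
  src (south x y) = vertex x y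
  tgt (east x y)  = vertex x (suc y)
  tgt (south x y) = vertex (suc x) y

  mean : Edge → Carrier
  mean e = proj₁ (expected (src e) (tgt e))

  hasMean : ∀ e → HasExpectation distribution (λ E → stretched E (src e) (tgt e)) (mean e)
  hasMean e = proj₁ (proj₂ (expected (src e) (tgt e)))

  Long : ℕ → Edge → DominatingEmbedding k dist → Set
  Long i e E = (2 ^ i) · 1# ≤ stretched E (src e) (tgt e)

  long-event : ∀ i e → Event (Long i e)
  long-event i e = tail (hasMean e) i

  mean≤α : ∀ e → dist (src e) (tgt e) ≈ 1# → mean e ≤ α
  mean≤α e d≈1 = ≤-trans (proj₂ (proj₂ (expected (src e) (tgt e))))
    (≤-reflexive (R.trans (R.*-congˡ d≈1) (R.*-identityʳ α)))

  toℕ-suc-mod : ∀ {x} → suc x ℕ.< n → toℕ (suc x mod n) ≡ suc (toℕ (x mod n))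
  toℕ-suc-mod x<n = trans (toℕ-mod x<n) (cong suc (sym (toℕ-mod (ℕₚ.<-trans (ℕₚ.n<1+n _) x<n))))

  east-dist : ∀ {x y} → suc y ℕ.< n → dist (vertex x y) (vertex x (suc y)) ≈ 1#
  east-dist y<n = ≤-antisym (dist-adjacent-≤ (inj₁ (refl , inj₁ (toℕ-suc-mod y<n))))
    (≤-trans (≤-reflexive (R.sym (R.+-identityʳ 1#)))
      (col-dist-≥ {1} (ℕₚ.≤-reflexive (trans (ℕₚ.+-comm _ 1) (sym (toℕ-suc-mod y<n))))))

  south-dist : ∀ {x y} → suc x ℕ.< n → dist (vertex x y) (vertex (suc x) y) ≈ 1#
  south-dist x<n = ≤-antisym (dist-adjacent-≤ (inj₂ (inj₁ (toℕ-suc-mod x<n) , refl)))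
    (≤-trans (≤-reflexive (R.sym (R.+-identityʳ 1#)))
      (row-dist-≥ {1} (ℕₚ.≤-reflexive (trans (ℕₚ.+-comm _ 1) (sym (toℕ-suc-mod x<n))))))

  module _ (M : ℕ) where
    -- Blocks at scale `i` have side `K * (4 * 2 ^ i)`, which divides `N` for every `i` up to `M`,
    -- so one subgrid is tiled exactly at all these scales.
    K N : ℕ
    K = suc (suc k)
    N = K ℕ.* (4 ℕ.* 2 ^ M)

    -- Edges start at coordinates below `N` but may end at `N`, hence the strict inequality.
    module _ (N<n : N ℕ.< n) where

      edges-mean : All (λ e → mean e ≤ α) (edges N)
      edges-mean = All-concatUpTo N λ {x} x<N → All-concatUpTo N λ {y} y<N →
        mean≤α (east x y) (east-dist (ℕₚ.≤-<-trans y<N N<n)) ∷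
        mean≤α (south x y) (south-dist (ℕₚ.≤-<-trans x<N N<n)) ∷ []

      -- There are `2 ^ j` blocks along each side, and each has at least `h = 2 * 2 ^ i` long edges.
      long-count : ∀ {i j} → i ℕ.+ j ≡ M → ∀ E {v} → Count (Long i) (long-event i) E (edges N) v →
        2 ^ j ℕ.* (2 ^ j ℕ.* (2 ℕ.* 2 ^ i)) ℕ.≤ v
      long-count {i} {j} refl E c with count-concatUpTo² (Long i) (long-event i) N N _ c
      ... | g , cg , refl = subst (λ N → q ℕ.* (q ℕ.* h) ℕ.≤ Σ< N (λ x → Σ< N (g x))) q*m≡N
        (grid-bound K h q g clear)
        where
        L = 2 ^ i
        h = 2 ℕ.* L
        q = 2 ^ j
        m = K ℕ.* (2 ℕ.* h)

        q*m≡N : q ℕ.* m ≡ N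
        q*m≡N = trans (rearrange q K L) (cong (λ z → K ℕ.* (4 ℕ.* z)) (sym (ℕₚ.^-distribˡ-+-* 2 i j)))
          where
          rearrange : ∀ q K L → q ℕ.* (K ℕ.* (2 ℕ.* (2 ℕ.* L))) ≡ K ℕ.* (4 ℕ.* (L ℕ.* q))
          rearrange = solve-∀

        block≤N : ∀ {p} → p ℕ.< q → p ℕ.* m ℕ.+ m ℕ.≤ N
        block≤N {p} p<q = subst₂ ℕ._≤_ (ℕₚ.+-comm m (p ℕ.* m)) q*m≡N (ℕₚ.*-monoˡ-≤ m p<q)

        inside : ∀ {p x} → p ℕ.< q → x ℕ.< m → p ℕ.* m ℕ.+ x ℕ.< N
        inside p<q x<m = ℕₚ.<-≤-trans (ℕₚ.+-monoʳ-< _ x<m) (block≤N p<q)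

        short : ∀ e → ¬ Long i e E → stretched E (src e) (tgt e) ≤ L · 1#
        short e ¬long lt = ¬long (<⇒≤ lt)

        zero⇒short : ∀ {x y v} → Count (Long i) (long-event i) E (east x y ∷ south x y ∷ []) v → v ≡ 0 →
          stretched E (vertex x y) (vertex x (suc y)) ≤ L · 1# × stretched E (vertex x y) (vertex (suc x) y) ≤ L · 1#
        zero⇒short (miss ¬e (miss ¬s [])) refl = short (east _ _) ¬e , short (south _ _) ¬s

        -- A zero count at a vertex makes both of its edges short; rows use the east edges and
        -- columns the south edges.
        clear : ∀ {p p′} → p ℕ.< q → p′ ℕ.< q → NoClearGrid K h g (p ℕ.* m) (p′ ℕ.* m)
        clear p<q p′<q rows cols = ClearGrid.no-clear-grid ℝ d E L _ _
          (ℕₚ.≤-<-trans (block≤N p<q) N<n) (ℕₚ.≤-<-trans (block≤N p′<q) N<n)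
          (λ s<K → let r , r<h , e = rows s<K in r , r<h , λ y<m →
            proj₁ (zero⇒short (cg (inside p<q (selected< s<K r<h)) (inside p′<q y<m)) (e y<m)))
          (λ s<K → let r , r<h , e = cols s<K in r , r<h , λ x<m →
            proj₂ (zero⇒short (cg (inside p<q x<m) (inside p′<q (selected< s<K r<h))) (e x<m)))

      W : ℕ
      W = 2 ℕ.* (2 ^ M ℕ.* 2 ^ M)

      -- Every scale contributes the same amount W to the total stretch.
      scale-bound : ∀ {i} → i ℕ.≤ M → W · 1# ≤ (2 ^ i) · Σᴸ (λ e → prob (long-event i e)) (edges N)
      scale-bound {i} i≤M with j , i+j≡M ← ℕₚ.m≤n⇒∃[o]m+o≡n i≤M = begin
        W · 1#                                                ≡⟨ cong (_· 1#) W≡ ⟩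
        (2 ^ i ℕ.* b) · 1#                                    ≈⟨ ·-assocˡ 1# (2 ^ i) b ⟨
        (2 ^ i) · (b · 1#)
          ≲⟨ ·-monoʳ-≤ (2 ^ i) (count-bound (Long i) (long-event i) (edges N) b (long-count {i} {j} i+j≡M)) ⟩
        (2 ^ i) · Σᴸ (λ e → prob (long-event i e)) (edges N)  ∎
        where
        open ≤-Reasoning
        b = 2 ^ j ℕ.* (2 ^ j ℕ.* (2 ℕ.* 2 ^ i))

        rearrange : ∀ x y → 2 ℕ.* ((x ℕ.* y) ℕ.* (x ℕ.* y)) ≡ x ℕ.* (y ℕ.* (y ℕ.* (2 ℕ.* x)))
        rearrange = solve-∀

        W≡ : W ≡ 2 ^ i ℕ.* b
        W≡ = trans (cong (λ z → 2 ℕ.* (z ℕ.* z)) (trans (cong (2 ^_) (sym i+j≡M)) (ℕₚ.^-distribˡ-+-* 2 i j)))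
                   (rearrange (2 ^ i) (2 ^ j))

      sum-lower : ∀ m {f : Fin m → Carrier} {x} → (∀ i → x ≤ f i) → m · x ≤ sum f
      sum-lower zero    le = ≤-refl
      sum-lower (suc m) le = +-mono-≤ (le Fin.zero) (sum-lower m (le ∘ Fin.suc))

      sum-Σᴸ : ∀ m (f : Fin m → Edge → Carrier) es →
        sum (λ i → Σᴸ (f i) es) ≈ Σᴸ (λ e → sum (λ i → f i e)) es
      sum-Σᴸ zero    f es = R.sym (Σᴸ-zero es)
      sum-Σᴸ (suc m) f es = R.trans (R.+-congˡ (sum-Σᴸ m (f ∘ Fin.suc) es)) (R.sym (Σᴸ-+ (f Fin.zero) _ es))

      -- Double counting over scales and edges: each scale contributes at least `W`, and each edge
      -- at most `3 · α` by `dyadic-tails`.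
      scales≤ : suc M · (W · 1#) ≤ (W ℕ.* (48 ℕ.* (K ℕ.* K))) · α
      scales≤ = begin
        suc M · (W · 1#)
          ≲⟨ sum-lower (suc M) (λ i → ≤-trans (scale-bound (Finₚ.toℕ≤pred[n] i))
               (≤-reflexive (R.sym (Σᴸ-· (2 ^ toℕ i) _ (edges N))))) ⟩
        sum {suc M} (λ i → Σᴸ (term (toℕ i)) (edges N))
          ≈⟨ sum-Σᴸ (suc M) (λ i → term (toℕ i)) (edges N) ⟩
        Σᴸ (λ e → sum {suc M} (λ i → term (toℕ i) e)) (edges N)
          ≲⟨ Σᴸ-mono (All.map (λ {e} mean≤ → ≤-trans (dyadic-tails (hasMean e) (suc M)) (·-monoʳ-≤ 3 mean≤)) edges-mean) ⟩
        Σᴸ (λ _ → 3 · α) (edges N)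
          ≈⟨ Σᴸ-const (3 · α) (edges N) ⟩
        length (edges N) · (3 · α)
          ≈⟨ ·-assocˡ α (length (edges N)) 3 ⟩
        (length (edges N) ℕ.* 3) · α
          -- There are twice `N * N` edges with `N = 4 * K * 2 ^ M`; with the factor 3 this is
          -- `96 * K * K` times `2 ^ M * 2 ^ M`, which is half of `W`.
          ≡⟨ cong (_· α) (trans (cong (ℕ._* 3) (length-edges N)) (rearrange K (2 ^ M))) ⟩
        (W ℕ.* (48 ℕ.* (K ℕ.* K))) · α ∎
        where
        open ≤-Reasoning
        term : ℕ → Edge → Carrier
        term i e = (2 ^ i) · prob (long-event i e)

        rearrange : ∀ K x → (K ℕ.* (4 ℕ.* x)) ℕ.* ((K ℕ.* (4 ℕ.* x)) ℕ.* 2) ℕ.* 3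
          ≡ 2 ℕ.* (x ℕ.* x) ℕ.* (48 ℕ.* (K ℕ.* K))
        rearrange = solve-∀

      scales≤α : suc M · 1# ≤ (48 ℕ.* (K ℕ.* K)) · α
      scales≤α = ·-cancelˡ-≤ W {{W≢0}} (begin
        W · (suc M · 1#)                  ≈⟨ ·-assocˡ 1# W (suc M) ⟩
        (W ℕ.* suc M) · 1#                ≡⟨ cong (_· 1#) (ℕₚ.*-comm W (suc M)) ⟩
        (suc M ℕ.* W) · 1#                ≈⟨ ·-assocˡ 1# (suc M) W ⟨
        suc M · (W · 1#)                  ≲⟨ scales≤ ⟩
        (W ℕ.* (48 ℕ.* (K ℕ.* K))) · α    ≈⟨ ·-assocˡ α W (48 ℕ.* (K ℕ.* K)) ⟨
        W · ((48 ℕ.* (K ℕ.* K)) · α)      ∎)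
        where
        open ≤-Reasoning
        W≢0 : ℕ.NonZero W
        W≢0 = ℕₚ.m*n≢0 2 (2 ^ M ℕ.* 2 ^ M) {{_}} {{ℕₚ.m*n≢0 (2 ^ M) (2 ^ M) {{ℕₚ.m^n≢0 2 M}} {{ℕₚ.m^n≢0 2 M}}}}

-- The choice of the constants.

n<2^n : ∀ n → n ℕ.< 2 ^ n
n<2^n zero    = ℕ.z<s
n<2^n (suc n) = ℕₚ.+-mono-≤ (ℕₚ.m^n>0 2 n) (ℕₚ.≤-trans (n<2^n n) (ℕₚ.m≤m+n _ 0))

theorem2 : (ℝ : Reals) (k : ℕ) →
    let open Reals ℝ
        open Metric ℝ in
    ∃[ c ] ∃[ n₀ ] (0# < c × (∀ n → n₀ ℕ.≤ n →
      (d : ShortestPathMetric (unitWeights (GRID n))) (α : Carrier) →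
      Approximation k (ShortestPathMetric.dist d) α →
      c * (⌈log₂ n ⌉ · 1#) ≤ α))
-- `c` is the inverse of `D`. The threshold makes the logarithm at least `suc κ`, so that `M` can be
-- the excess over it.
theorem2 ℝ k = proj₁ inverse , 2 ^ suc κ , proj₁ (proj₂ inverse) , bound
  where
  open Reals ℝ
  open Metric ℝ
  open RealProperties ℝ

  K κ C D : ℕ
  K = suc (suc k)
  κ = K ℕ.* 4
  C = 48 ℕ.* (K ℕ.* K)
  D = suc κ ℕ.* C

  instance
    D≢0 : ℕ.NonZero D
    D≢0 = ℕₚ.m*n≢0 (suc κ) C {{_}} {{ℕₚ.m*n≢0 48 (K ℕ.* K) {{_}} {{ℕₚ.m*n≢0 K K}}}}

  inverse : ∃[ c ] (0# < c × c * (D · 1#) ≈ 1#)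
  inverse = nat-inverse D

  bound : ∀ n → 2 ^ suc κ ℕ.≤ n →
    (d : ShortestPathMetric (unitWeights (GRID n))) (α : Carrier) →
    Approximation k (ShortestPathMetric.dist d) α →
    proj₁ inverse * (⌈log₂ n ⌉ · 1#) ≤ α
  bound n n₀≤n d α approx = divide-≤ D (proj₂ (proj₂ inverse)) (begin
    ⌈log₂ n ⌉ · 1#            ≲⟨ ·-monoˡ-≤ 0≤1 log≤ ⟩
    (suc κ ℕ.* suc M) · 1#    ≈⟨ ·-assocˡ 1# (suc κ) (suc M) ⟨
    suc κ · (suc M · 1#)      ≲⟨ ·-monoʳ-≤ (suc κ) (LowerBound.scales≤α ℝ {{n≢0}} d approx M N<n) ⟩
    suc κ · (C · α)           ≈⟨ ·-assocˡ α (suc κ) C ⟩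
    D · α                     ∎)
    where
    open ≤-Reasoning

    n≢0 : ℕ.NonZero n
    n≢0 = ℕ.>-nonZero (ℕₚ.<-≤-trans (ℕₚ.m^n>0 2 (suc κ)) n₀≤n)

    scales : ∃[ M ] suc κ ℕ.+ M ≡ ⌈log₂ n ⌉
    scales = ℕₚ.m≤n⇒∃[o]m+o≡n (subst (ℕ._≤ ⌈log₂ n ⌉) (⌈log₂2^n⌉≡n (suc κ)) (⌈log₂⌉-mono-≤ n₀≤n))

    M : ℕ
    M = proj₁ scales

    -- The additive loss `suc κ` is turned into a factor, which `D` absorbs.
    log≤ : ⌈log₂ n ⌉ ℕ.≤ suc κ ℕ.* suc M
    log≤ = subst₂ ℕ._≤_ (proj₂ scales) (sym (ℕₚ.*-suc (suc κ) M)) (ℕₚ.+-monoʳ-≤ (suc κ) (ℕₚ.m≤n*m M (suc κ)))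

    -- The exponent is one less than the rounded-up logarithm of `n`.
    2^[κ+M]<n : 2 ^ (κ ℕ.+ M) ℕ.< n
    2^[κ+M]<n = ℕₚ.≰⇒> λ n≤ → ℕₚ.1+n≰n (subst₂ ℕ._≤_ (sym (proj₂ scales)) (⌈log₂2^n⌉≡n (κ ℕ.+ M)) (⌈log₂⌉-mono-≤ n≤))

    -- The factor `K * 4` is `κ`, which is below `2 ^ κ`.
    N<n : K ℕ.* (4 ℕ.* 2 ^ M) ℕ.< n
    N<n = ℕₚ.≤-<-trans (subst₂ ℕ._≤_ (ℕₚ.*-assoc K 4 (2 ^ M)) (sym (ℕₚ.^-distribˡ-+-* 2 κ M))
      (ℕₚ.*-monoˡ-≤ (2 ^ M) (ℕₚ.<⇒≤ (n<2^n κ)))) 2^[κ+M]<n
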